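{- Let $q$ be a prime power, let $k\ge 2$, and let $\mathfrak m=(m_1,\dots,m_k)$ and $\mathfrak n=(n_1,\dots,n_k)$ range over $k$-tuples of nonnegative integers. Then $$\lim_{m_{k-1},\,m_k\to\infty}\frac{P_k(\mathfrak m;\mathfrak n)}{N_k(\mathfrak m)N_k(\mathfrak n)}=1,$$ i.e. for every $\varepsilon>0$ there is $M$ such that $\Bigl|\frac{P_k(\mathfrak m;\mathfrak n)}{N_k(\mathfrak m)N_k(\mathfrak n)}-1\Bigr|<\varepsilon$ whenever $m_{k-1}\ge M$ and $m_k\ge M$ (with no restriction on the other coordinates of $\mathfrak m$ or on $\mathfrak n$).
   Context: $\mathbb F_q$ is the finite field with $q$ elements. Two polynomials in $\mathbb F_q[x_1,\dots,x_k]$ are identified if they differ by a factor in $\mathbb F_q^\times$; the classes are called normalized polynomials. The vector degree of a nonzero $f$ is $\operatorname{Deg} f=(\deg_{x_1}f,\dots,\deg_{x_k}f)$. For a $k$-tuple $\mathfrak m$ of nonnegative integers, $\mathcal N_k(\mathfrak m)$ is the set of normalized polynomials $f\in\mathbb F_q[x_1,\dots,x_k]$ with $\operatorname{Deg} f=\mathfrak m$, and $N_k(\mathfrak m)=|\mathcal N_k(\mathfrak m)|$. $P_k(\mathfrak m;\mathfrak n)=|\{(f,g)\in\mathcal N_k(\mathfrak m)\times\mathcal N_k(\mathfrak n):\gcd(f,g)=1\}|$. -}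

module Defs where

open import Algebra.Bundles using (CommutativeRing; RawSemiring)
open import Algebra.Definitions.RawMagma using (_,_)
import Algebra.Definitions.RawSemiring as RawSemiringDefinitions
open import Data.Empty using (⊥; ⊥-elim)
open import Data.Fin using (Fin; zero; suc)
import Data.Integer as ℤ
open import Data.List using (List; []; _∷_; foldr; map; filter; length; upTo; deduplicate; cartesianProduct; cartesianProductWith)
import Data.List.Extrema.Nat as Extrema
import Data.List.Membership.Setoid as SetoidMembership
import Data.List.Membership.Setoid.Properties as SetoidMembershipₚ
open import Data.List.Membership.Propositional using (_∈_; find; lose)
open import Data.List.Membership.Propositional.Properties using (∈-upTo⁺; ∈-upTo⁻; ∈-filter⁺; ∈-filter⁻; ∈-map⁺; ∈-cartesianProductWith⁺; ∈-cartesianProductWith⁻)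
open import Data.List.Relation.Unary.All as All using (All; []; _∷_)
import Data.List.Relation.Unary.All.Properties as Allₚ
open import Data.List.Relation.Unary.AllPairs using ([]; _∷_)
open import Data.List.Relation.Unary.Any as Any using (Any; here; there)
import Data.List.Relation.Unary.Any.Properties as Anyₚ
import Data.List.Relation.Unary.Enumerates.Setoid as Enumerates
import Data.List.Relation.Unary.Enumerates.Setoid.Properties as Enumeratesₚ
import Data.List.Relation.Unary.Unique.DecSetoid.Properties as UniqueDec
open import Data.List.Relation.Unary.Unique.Propositional using () renaming (Unique to Unique≡)
import Data.List.Relation.Unary.Unique.Propositional.Properties as Uniqueₚ
import Data.List.Relation.Unary.Unique.Setoid as UniqueSetoid
open import Data.Nat using (ℕ; zero; suc; z≤n; s≤s)
import Data.Nat as ℕ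
import Data.Nat.Properties as ℕₚ
open import Data.Product using (Σ; ∃; _×_; _,_; proj₁; proj₂)
open import Data.Product.Relation.Binary.Pointwise.NonDependent using (_×ₛ_; ×-decSetoid)
open import Data.Rational using (ℚ; _/_)
open import Data.Sum using (_⊎_; inj₁; inj₂)
open import Data.Vec using (Vec; []; _∷_; lookup; tabulate; replicate; zipWith)
import Data.Vec.Properties as Vecₚ
open import Data.Vec.Relation.Binary.Pointwise.Inductive as Pointwise using (Pointwise; []; _∷_)
open import Function using (_∘_; id; case_of_)
open import Level using (Level; _⊔_) renaming (suc to lsuc)
open import Relation.Binary using (Setoid; DecSetoid; tri<; tri≈; tri>)
import Relation.Binary.Construct.On as On
open import Relation.Binary.PropositionalEquality as ≡ using (_≡_)
import Relation.Binary.Reasoning.Setoid as SetoidReasoning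
open import Relation.Nullary using (¬_; Dec; yes; no; contradiction)
import Relation.Nullary.Decidable as Dec
open import Relation.Nullary.Decidable using (¬?; _×-dec_; _→-dec_; decidable-stable)
open import Relation.Unary using (Pred; Decidable)

private
  variable
    a ℓ p : Level

-- Uniqueness is with respect to the setoid equality, so card is the number of
-- equivalence classes.
record Finite (S : Setoid a ℓ) : Set (a ⊔ ℓ) where
  open Setoid S using (Carrier)
  open Enumerates S using (IsEnumeration)
  open UniqueSetoid S using (Unique)
  field
    elements : List Carrier
    complete : IsEnumeration elements
    unique   : Unique elements

  card : ℕ
  card = length elements

-- The order card finite is necessarily a prime power q, and a finite field of
-- order q is unique up to isomorphism, so quantifying over all finite fields
-- amounts to quantifying over all prime powers.
record FiniteField c ℓ : Set (lsuc (c ⊔ ℓ)) where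
  field
    commutativeRing : CommutativeRing c ℓ
  open CommutativeRing commutativeRing
  field
    nontrivial : ¬ 1# ≈ 0#
    inverse    : ∀ x → ¬ x ≈ 0# → ∃ λ y → x * y ≈ 1#
    finite     : Finite setoid

-- The vector e stands for the monomial x₁^e₁ ⋯ x_k^e_k.
Monomial : ℕ → Set
Monomial k = Vec ℕ k

infix 4 _≤ₘ_ _≤ₘ?_ _≟ₘ_

_≤ₘ_ : ∀ {k} → Monomial k → Monomial k → Set
_≤ₘ_ = Pointwise ℕ._≤_

_≤ₘ?_ : ∀ {k} (d e : Monomial k) → Dec (d ≤ₘ e)
_≤ₘ?_ = Pointwise.decidable ℕ._≤?_

_≟ₘ_ : ∀ {k} (d e : Monomial k) → Dec (d ≡ e)
_≟ₘ_ = Vecₚ.≡-dec ℕ._≟_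

-- All monomials dividing e, each listed once.
box : ∀ {k} → Monomial k → List (Monomial k)
box []      = [] ∷ []
box (n ∷ e) = cartesianProductWith _∷_ (upTo (suc n)) (box e)

module _ (S : Setoid a ℓ) where
  open Setoid S
  open SetoidMembership S using () renaming (_∈_ to _∈ₛ_)
  open UniqueSetoid S using (Unique)

  decideBy : ∀ {xs x y} → Unique xs → x ∈ₛ xs → y ∈ₛ xs → Dec (x ≈ y)
  decideBy _        (here x≈z)  (here y≈z)  = yes (trans x≈z (sym y≈z))
  decideBy (z∉ ∷ _) (here x≈z)  (there y∈) =
    no λ x≈y → SetoidMembershipₚ.All[≉]⇒∉ S z∉ (SetoidMembershipₚ.∈-resp-≈ S (trans (sym x≈y) x≈z) y∈)
  decideBy (z∉ ∷ _) (there x∈) (here y≈z)  =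
    no λ x≈y → SetoidMembershipₚ.All[≉]⇒∉ S z∉ (SetoidMembershipₚ.∈-resp-≈ S (trans x≈y y≈z) x∈)
  decideBy (_ ∷ u)  (there x∈) (there y∈) = decideBy u x∈ y∈

Finite⇒≟ : {S : Setoid a ℓ} → Finite S → ∀ x y → Dec (Setoid._≈_ S x y)
Finite⇒≟ {S = S} fin x y = decideBy S unique (complete x) (complete y)
  where open Finite fin

enumeration⇒Finite : (D : DecSetoid a ℓ) (xs : List (DecSetoid.Carrier D)) →
                     Enumerates.IsEnumeration (DecSetoid.setoid D) xs → Finite (DecSetoid.setoid D)
enumeration⇒Finite D xs all∈xs = record
  { elements = deduplicate (DecSetoid._≟_ D) xs
  ; complete = Enumeratesₚ.deduplicate⁺ D all∈xs
  ; unique   = UniqueDec.deduplicate-! D xs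
  }

module _ {A : Set a} {P : Pred A p} (P? : Decidable P) where

  sieve : List A → List (Σ A P)
  sieve []       = []
  sieve (x ∷ xs) with P? x
  ... | yes px = (x , px) ∷ sieve xs
  ... | no  _  = sieve xs

  sieve⁺ : ∀ {q} {Q : Pred A q} → (∀ {x} → Q x → P x) →
           ∀ {xs} → Any Q xs → Any (Q ∘ proj₁) (sieve xs)
  sieve⁺ Q⊆P {x ∷ xs} any with P? x
  sieve⁺ Q⊆P (here qx)   | yes px = here qx
  sieve⁺ Q⊆P (there any) | yes px = there (sieve⁺ Q⊆P any)
  sieve⁺ Q⊆P (here qx)   | no ¬px = contradiction (Q⊆P qx) ¬px
  sieve⁺ Q⊆P (there any) | no ¬px = sieve⁺ Q⊆P any

module Polynomials {c ℓ} (F : FiniteField c ℓ) where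

  open FiniteField F
  open CommutativeRing commutativeRing public
    using () renaming (Carrier to 𝔽; _≈_ to _≈𝔽_)
  open CommutativeRing commutativeRing
    hiding (Carrier; _≈_; zero)

  infix 4 _≟𝔽_

  _≟𝔽_ : ∀ x y → Dec (x ≈𝔽 y)
  _≟𝔽_ = Finite⇒≟ finite

  -- A polynomial is a finitely supported coefficient function.  The bound
  -- only witnesses finiteness of the support; it need not be sharp and is
  -- ignored by the equality of polynomials.
  record Poly (k : ℕ) : Set (c ⊔ ℓ) where
    constructor mkPoly
    field
      coeff   : Monomial k → 𝔽
      bound   : Monomial k
      bounded : ∀ e → ¬ (e ≤ₘ bound) → coeff e ≈𝔽 0#

  open Poly public

  infix 4 _≈ₚ_

  _≈ₚ_ : ∀ {k} → Poly k → Poly k → Set ℓ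
  f ≈ₚ g = ∀ e → coeff f e ≈𝔽 coeff g e

  polySetoid : ℕ → Setoid (c ⊔ ℓ) ℓ
  polySetoid k = record
    { Carrier       = Poly k
    ; _≈_           = _≈ₚ_
    ; isEquivalence = record
      { refl  = λ e → refl
      ; sym   = λ f≈g e → sym (f≈g e)
      ; trans = λ f≈g g≈h e → trans (f≈g e) (g≈h e)
      }
    }

  infixr 6 _⊔ₘ_ _+ₘ_
  infixl 6 _∸ₘ_

  _⊔ₘ_ _+ₘ_ _∸ₘ_ : ∀ {k} → Monomial k → Monomial k → Monomial k
  _⊔ₘ_ = zipWith ℕ._⊔_
  _+ₘ_ = zipWith ℕ._+_
  _∸ₘ_ = zipWith ℕ._∸_

  ≤ₘ-refl : ∀ {k} {e : Monomial k} → e ≤ₘ e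
  ≤ₘ-refl = Pointwise.refl ℕₚ.≤-refl

  ≤⊔ˡ : ∀ {k} (d e : Monomial k) → d ≤ₘ d ⊔ₘ e
  ≤⊔ˡ []      []      = []
  ≤⊔ˡ (m ∷ d) (n ∷ e) = ℕₚ.m≤m⊔n m n ∷ ≤⊔ˡ d e

  ≤⊔ʳ : ∀ {k} (d e : Monomial k) → e ≤ₘ d ⊔ₘ e
  ≤⊔ʳ []      []      = []
  ≤⊔ʳ (m ∷ d) (n ∷ e) = ℕₚ.m≤n⊔m m n ∷ ≤⊔ʳ d e

  ≤ₘ-trans : ∀ {k} {d e f : Monomial k} → d ≤ₘ e → e ≤ₘ f → d ≤ₘ f
  ≤ₘ-trans = Pointwise.trans ℕₚ.≤-trans

  ≤+ : ∀ {k} (b b′ a e : Monomial k) → a ≤ₘ b → e ∸ₘ a ≤ₘ b′ → e ≤ₘ b +ₘ b′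
  ≤+ [] [] [] [] [] [] = []
  ≤+ (m ∷ b) (m′ ∷ b′) (i ∷ a) (n ∷ e) (i≤m ∷ a≤b) (n∸i≤m′ ∷ e∸a≤b′) =
    ℕₚ.≤-trans (ℕₚ.m≤n+m∸n n i) (ℕₚ.+-mono-≤ i≤m n∸i≤m′) ∷ ≤+ b b′ a e a≤b e∸a≤b′

  sumOver : {A : Set} → List A → (A → 𝔽) → 𝔽
  sumOver xs h = foldr (λ x s → h x + s) 0# xs

  sum-cong : {A : Set} (xs : List A) {h h′ : A → 𝔽} → (∀ x → h x ≈𝔽 h′ x) →
             sumOver xs h ≈𝔽 sumOver xs h′
  sum-cong []       h≈h′ = refl
  sum-cong (x ∷ xs) h≈h′ = +-cong (h≈h′ x) (sum-cong xs h≈h′)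

  sum-zero : {A : Set} (xs : List A) {h : A → 𝔽} → (∀ {x} → x ∈ xs → h x ≈𝔽 0#) →
             sumOver xs h ≈𝔽 0#
  sum-zero []       h≈0 = refl
  sum-zero (x ∷ xs) h≈0 =
    trans (+-cong (h≈0 (here ≡.refl)) (sum-zero xs (h≈0 ∘ there))) (+-identityˡ 0#)

  infixl 7 _*ₚ_ _·ₚ_
  infixl 6 _+ₚ_

  0ₚ : ∀ {k} → Poly k
  0ₚ = mkPoly (λ _ → 0#) (replicate _ 0) (λ _ _ → refl)

  term : ∀ {k} → 𝔽 → Monomial k → Poly k
  term {k} x e = mkPoly co e off
    where
    co : Monomial k → 𝔽
    co e′ with e ≟ₘ e′
    ... | yes _ = x
    ... | no  _ = 0#
    off : ∀ e′ → ¬ (e′ ≤ₘ e) → co e′ ≈𝔽 0#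
    off e′ e′≰e with e ≟ₘ e′
    ... | yes ≡.refl = contradiction ≤ₘ-refl e′≰e
    ... | no  _      = refl

  1ₚ : ∀ {k} → Poly k
  1ₚ = term 1# (replicate _ 0)

  _+ₚ_ : ∀ {k} → Poly k → Poly k → Poly k
  f +ₚ g = mkPoly (λ e → coeff f e + coeff g e) (bound f ⊔ₘ bound g) λ e e≰ →
    trans (+-cong (bounded f e (λ e≤ → e≰ (≤ₘ-trans e≤ (≤⊔ˡ (bound f) (bound g)))))
                  (bounded g e (λ e≤ → e≰ (≤ₘ-trans e≤ (≤⊔ʳ (bound f) (bound g))))))
          (+-identityˡ 0#)

  _·ₚ_ : ∀ {k} → 𝔽 → Poly k → Poly k
  x ·ₚ f = mkPoly (λ e → x * coeff f e) (bound f) λ e e≰ →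
    trans (*-congˡ (bounded f e e≰)) (zeroʳ x)

  _*ₚ_ : ∀ {k} → Poly k → Poly k → Poly k
  f *ₚ g = mkPoly
    (λ e → sumOver (box e) λ a → coeff f a * coeff g (e ∸ₘ a))
    (bound f +ₘ bound g)
    (λ e e≰ → sum-zero (box e) (λ {a} _ → vanish e a e≰))
    where
    vanish : ∀ e a → ¬ (e ≤ₘ bound f +ₘ bound g) → coeff f a * coeff g (e ∸ₘ a) ≈𝔽 0#
    vanish e a e≰ with a ≤ₘ? bound f
    ... | no  a≰ = trans (*-congʳ (bounded f a a≰)) (zeroˡ _)
    ... | yes a≤ = trans (*-congˡ (bounded g (e ∸ₘ a) (λ e∸a≤ → e≰ (≤+ _ _ a e a≤ e∸a≤)))) (zeroʳ _)

  polyRawSemiring : ℕ → RawSemiring (c ⊔ ℓ) ℓ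
  polyRawSemiring k = record
    { Carrier = Poly k
    ; _≈_     = _≈ₚ_
    ; _+_     = _+ₚ_
    ; _*_     = _*ₚ_
    ; 0#      = 0ₚ
    ; 1#      = 1ₚ
    }

  -- Coprime f g says that every common divisor divides 1, i.e. that 1 is a
  -- greatest common divisor of f and g.
  module _ {k : ℕ} where
    open RawSemiringDefinitions (polyRawSemiring k) public
      using (_∣_; Coprime)

  support : ∀ {k} → Poly k → List (Monomial k)
  support f = filter (λ e → ¬? (coeff f e ≟𝔽 0#)) (box (bound f))

  degree : ∀ {k} → Fin k → Poly k → ℕ
  degree i f = Extrema.max 0 (map (λ e → lookup e i) (support f))

  -- Only meaningful for nonzero f; the value at 0ₚ is the zero vector.
  Deg : ∀ {k} → Poly k → Vec ℕ k
  Deg f = tabulate (λ i → degree i f)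

  infix 4 _∼_

  _∼_ : ∀ {k} → Poly k → Poly k → Set (c ⊔ ℓ)
  f ∼ g = ∃ λ x → ¬ x ≈𝔽 0# × x ·ₚ f ≈ₚ g

  HasDeg : ∀ {k} → Vec ℕ k → Poly k → Set ℓ
  HasDeg m f = ¬ f ≈ₚ 0ₚ × Deg f ≡ m

  inv≉0 : ∀ {x y} → x * y ≈𝔽 1# → ¬ y ≈𝔽 0#
  inv≉0 {x} xy≈1 y≈0 = nontrivial (trans (sym xy≈1) (trans (*-congˡ y≈0) (zeroʳ x)))

  *-nonzero : ∀ {x y} → ¬ x ≈𝔽 0# → ¬ y ≈𝔽 0# → ¬ x * y ≈𝔽 0#
  *-nonzero {x} {y} x≉0 y≉0 xy≈0 with x⁻¹ , xx⁻¹≈1 ← inverse x x≉0 = y≉0 (begin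
    y               ≈⟨ *-identityˡ y ⟨
    1# * y          ≈⟨ *-congʳ xx⁻¹≈1 ⟨
    x * x⁻¹ * y     ≈⟨ *-congʳ (*-comm x x⁻¹) ⟩
    x⁻¹ * x * y     ≈⟨ *-assoc x⁻¹ x y ⟩
    x⁻¹ * (x * y)   ≈⟨ *-congˡ xy≈0 ⟩
    x⁻¹ * 0#        ≈⟨ zeroʳ x⁻¹ ⟩
    0#              ∎)
    where open SetoidReasoning setoid

  ∼-reflexive : ∀ {k} (f g : Poly k) → f ≈ₚ g → f ∼ g
  ∼-reflexive f g f≈g = 1# , nontrivial , λ e → trans (*-identityˡ _) (f≈g e)

  ·-inv : ∀ {k} (f g : Poly k) {x y} → x * y ≈𝔽 1# → x ·ₚ f ≈ₚ g → y ·ₚ g ≈ₚ f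
  ·-inv f g {x} {y} xy≈1 xf≈g e = begin
    y * coeff g e        ≈⟨ *-congˡ (xf≈g e) ⟨
    y * (x * coeff f e)  ≈⟨ *-assoc y x _ ⟨
    y * x * coeff f e    ≈⟨ *-congʳ (trans (*-comm y x) xy≈1) ⟩
    1# * coeff f e       ≈⟨ *-identityˡ _ ⟩
    coeff f e            ∎
    where open SetoidReasoning setoid

  ∼-sym : ∀ {k} (f g : Poly k) → f ∼ g → g ∼ f
  ∼-sym f g (x , x≉0 , xf≈g) with y , xy≈1 ← inverse x x≉0 =
    y , inv≉0 xy≈1 , ·-inv f g xy≈1 xf≈g

  ∼-trans : ∀ {k} (f g h : Poly k) → f ∼ g → g ∼ h → f ∼ h
  ∼-trans f g h (x , x≉0 , xf≈g) (y , y≉0 , yg≈h) =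
    y * x , *-nonzero y≉0 x≉0 ,
    λ e → trans (*-assoc y x _) (trans (*-congˡ (xf≈g e)) (yg≈h e))

  -- The elements of 𝒩 m are classes modulo 𝔽ˣ: the setoid equality is
  -- proportionality, so Finite.card counts normalized polynomials.
  𝒩 : ∀ {k} → Vec ℕ k → Setoid (c ⊔ ℓ) (c ⊔ ℓ)
  𝒩 m = record
    { Carrier       = ∃ (HasDeg m)
    ; _≈_           = λ f g → proj₁ f ∼ proj₁ g
    ; isEquivalence = record
      { refl  = λ {(f , _)} → ∼-reflexive f f (λ e → refl)
      ; sym   = λ {(f , _)} {(g , _)} → ∼-sym f g
      ; trans = λ {(f , _)} {(g , _)} {(h , _)} → ∼-trans f g h
      }
    }

  CoprimePair : ∀ {k} (m n : Vec ℕ k) → Pred (Setoid.Carrier (𝒩 m ×ₛ 𝒩 n)) (c ⊔ ℓ)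
  CoprimePair m n ((f , _) , (g , _)) = Coprime f g

  𝒫 : ∀ {k} → Vec ℕ k → Vec ℕ k → Setoid (c ⊔ ℓ) (c ⊔ ℓ)
  𝒫 m n = On.setoid (𝒩 m ×ₛ 𝒩 n) (proj₁ {B = CoprimePair m n})

  ∈-box⁺ : ∀ {k} {d e : Monomial k} → d ≤ₘ e → d ∈ box e
  ∈-box⁺ []          = here ≡.refl
  ∈-box⁺ (i≤n ∷ d≤e) = ∈-cartesianProductWith⁺ _∷_ (∈-upTo⁺ (s≤s i≤n)) (∈-box⁺ d≤e)

  ∈-box⁻ : ∀ {k} {d : Monomial k} (e : Monomial k) → d ∈ box e → d ≤ₘ e
  ∈-box⁻ {d = []} [] _ = []
  ∈-box⁻ (n ∷ e) d∈ with ∈-cartesianProductWith⁻ _∷_ (upTo (suc n)) (box e) d∈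
  ... | i , d′ , i∈ , d′∈ , ≡.refl = ℕₚ.≤-pred (∈-upTo⁻ i∈) ∷ ∈-box⁻ e d′∈

  box-unique : ∀ {k} (e : Monomial k) → Unique≡ (box e)
  box-unique []      = [] ∷ []
  box-unique (n ∷ e) =
    Uniqueₚ.cartesianProductWith⁺ _∷_ Vecₚ.∷-injective (Uniqueₚ.upTo⁺ (suc n)) (box-unique e)

  ∈-support⁺ : ∀ {k} (f : Poly k) {e} → ¬ coeff f e ≈𝔽 0# → e ∈ support f
  ∈-support⁺ f {e} fe≉0 = ∈-filter⁺ _ (∈-box⁺ (decidable-stable (e ≤ₘ? bound f) (fe≉0 ∘ bounded f e))) fe≉0

  ∈-support⁻ : ∀ {k} (f : Poly k) {e} → e ∈ support f → ¬ coeff f e ≈𝔽 0#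
  ∈-support⁻ f e∈ = proj₂ (∈-filter⁻ (λ e → ¬? (coeff f e ≟𝔽 0#)) {xs = box (bound f)} e∈)

  ≤ₘ-bound : ∀ {k} (f : Poly k) {e} → ¬ coeff f e ≈𝔽 0# → e ≤ₘ bound f
  ≤ₘ-bound f {e} fe≉0 = decidable-stable (e ≤ₘ? bound f) (fe≉0 ∘ bounded f e)

  ≤-degree : ∀ {k} (f : Poly k) i {e} → ¬ coeff f e ≈𝔽 0# → lookup e i ℕ.≤ degree i f
  ≤-degree f i fe≉0 = All.lookup (Extrema.xs≤max 0 _) (∈-map⁺ _ (∈-support⁺ f fe≉0))

  degree-≤ : ∀ {k} (f : Poly k) i {n} → (∀ {e} → ¬ coeff f e ≈𝔽 0# → lookup e i ℕ.≤ n) → degree i f ℕ.≤ n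
  degree-≤ f i h = Extrema.max≤v⁺ z≤n (Allₚ.map⁺ (All.tabulate (h ∘ ∈-support⁻ f)))

  degree-mono : ∀ {k} (f g : Poly k) → f ≈ₚ g → ∀ i → degree i f ℕ.≤ degree i g
  degree-mono f g f≈g i = degree-≤ f i (λ fe≉0 → ≤-degree g i (fe≉0 ∘ trans (f≈g _)))

  Deg-cong : ∀ {k} (f g : Poly k) → f ≈ₚ g → Deg f ≡ Deg g
  Deg-cong f g f≈g = Vecₚ.tabulate-cong λ i →
    ℕₚ.≤-antisym (degree-mono f g f≈g i) (degree-mono g f (λ e → sym (f≈g e)) i)

  HasDeg-resp : ∀ {k m} (f g : Poly k) → f ≈ₚ g → HasDeg m f → HasDeg m g
  HasDeg-resp f g f≈g (f≉0 , d) =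
    (λ g≈0 → f≉0 λ e → trans (f≈g e) (g≈0 e)) ,
    ≡.trans (Deg-cong g f (λ e → sym (f≈g e))) d

  lookup⇒≤ₘ : ∀ {k} (d e : Monomial k) → (∀ i → lookup d i ℕ.≤ lookup e i) → d ≤ₘ e
  lookup⇒≤ₘ []      []      h = []
  lookup⇒≤ₘ (m ∷ d) (n ∷ e) h = h zero ∷ lookup⇒≤ₘ d e (h ∘ suc)

  ≤ₘ-Deg : ∀ {k} (f : Poly k) {e} → ¬ coeff f e ≈𝔽 0# → e ≤ₘ Deg f
  ≤ₘ-Deg f {e} fe≉0 = lookup⇒≤ₘ e (Deg f) λ i →
    ℕₚ.≤-trans (≤-degree f i fe≉0) (ℕₚ.≤-reflexive (≡.sym (Vecₚ.lookup∘tabulate _ i)))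

  nonzero⇒support : ∀ {k} (f : Poly k) → ¬ f ≈ₚ 0ₚ → ∃ λ e → e ∈ support f
  nonzero⇒support f f≉0 = go (support f) ≡.refl
    where
    go : ∀ xs → xs ≡ support f → ∃ λ e → e ∈ xs
    go (e ∷ _) _  = e , here ≡.refl
    go []      eq = contradiction
      (λ e → decidable-stable (coeff f e ≟𝔽 0#)
               λ fe≉0 → case ≡.subst (e ∈_) (≡.sym eq) (∈-support⁺ f fe≉0) of λ ())
      f≉0

  infix 4 _≟ₚ_

  _≟ₚ_ : ∀ {k} (f g : Poly k) → Dec (f ≈ₚ g)
  f ≟ₚ g = Dec.map′ to (λ f≈g → All.universal f≈g _)
    (All.all? (λ e → coeff f e ≟𝔽 coeff g e) (box b))
    where
    b = bound f ⊔ₘ bound g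
    to : All (λ e → coeff f e ≈𝔽 coeff g e) (box b) → f ≈ₚ g
    to all e with e ≤ₘ? b
    ... | yes e≤ = All.lookup all (∈-box⁺ e≤)
    ... | no  e≰ = trans (bounded f e (λ e≤ → e≰ (≤ₘ-trans e≤ (≤⊔ˡ (bound f) (bound g)))))
                    (sym (bounded g e (λ e≤ → e≰ (≤ₘ-trans e≤ (≤⊔ʳ (bound f) (bound g))))))

  open Finite finite using () renaming (elements to scalars; complete to scalars-complete)

  any-scalar? : ∀ {p} {P : Pred 𝔽 p} → Decidable P → (∀ {x y} → x ≈𝔽 y → P x → P y) → Dec (∃ P)
  any-scalar? P? resp = Dec.map′ Any.satisfied
    (λ (x , px) → Any.map (λ x≈y → resp x≈y px) (scalars-complete x))
    (Any.any? P? scalars)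

  infix 4 _∼?_

  _∼?_ : ∀ {k} (f g : Poly k) → Dec (f ∼ g)
  f ∼? g = any-scalar? (λ x → ¬? (x ≟𝔽 0#) ×-dec x ·ₚ f ≟ₚ g)
    (λ x≈y (x≉0 , xf≈g) → (x≉0 ∘ trans x≈y) , λ e → trans (*-congʳ (sym x≈y)) (xf≈g e))

  truncate : ∀ {k} → Monomial k → (Monomial k → 𝔽) → Poly k
  truncate {k} b h = mkPoly co b off
    where
    co : Monomial k → 𝔽
    co e with e ≤ₘ? b
    ... | yes _ = h e
    ... | no  _ = 0#
    off : ∀ e → ¬ (e ≤ₘ b) → co e ≈𝔽 0#
    off e e≰ with e ≤ₘ? b
    ... | yes e≤ = contradiction e≤ e≰
    ... | no  _  = refl

  update : ∀ {k} → Monomial k → 𝔽 → (Monomial k → 𝔽) → (Monomial k → 𝔽)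
  update e x h e′ with e ≟ₘ e′
  ... | yes _ = x
  ... | no  _ = h e′

  functionsOn : ∀ {k} → List (Monomial k) → List (Monomial k → 𝔽)
  functionsOn []       = (λ _ → 0#) ∷ []
  functionsOn (e ∷ es) = cartesianProductWith (update e) scalars (functionsOn es)

  AgreeOn : ∀ {k} → List (Monomial k) → (h h′ : Monomial k → 𝔽) → Set ℓ
  AgreeOn es h h′ = ∀ {e} → e ∈ es → h e ≈𝔽 h′ e

  functionsOn-complete : ∀ {k} (es : List (Monomial k)) h → Any (AgreeOn es h) (functionsOn es)
  functionsOn-complete []       h = here λ ()
  functionsOn-complete (e ∷ es) h =
    Anyₚ.cartesianProductWith⁺ (update e) agree (scalars-complete (h e)) (functionsOn-complete es h)
    where
    agree : ∀ {x h′} → h e ≈𝔽 x → AgreeOn es h h′ → AgreeOn (e ∷ es) h (update e x h′)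
    agree he≈x ag {e′} e′∈ with e ≟ₘ e′
    agree he≈x ag e′∈         | yes ≡.refl = he≈x
    agree he≈x ag (here e′≡e) | no  e≢e′   = contradiction (≡.sym e′≡e) e≢e′
    agree he≈x ag (there e′∈) | no  _      = ag e′∈

  -- Up to ≈ₚ, these are all polynomials supported in box b.
  boxPolys : ∀ {k} → Monomial k → List (Poly k)
  boxPolys b = map (truncate b) (functionsOn (box b))

  boxPolys-complete : ∀ {k} (b : Monomial k) (f : Poly k) →
                      (∀ {e} → ¬ coeff f e ≈𝔽 0# → e ≤ₘ b) → Any (f ≈ₚ_) (boxPolys b)
  boxPolys-complete b f f≤b =
    Anyₚ.map⁺ (Any.map (λ {h} → agree h) (functionsOn-complete (box b) (coeff f)))
    where
    agree : ∀ h → AgreeOn (box b) (coeff f) h → f ≈ₚ truncate b h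
    agree h ag e with e ≤ₘ? b
    ... | yes e≤ = ag (∈-box⁺ e≤)
    ... | no  e≰ = decidable-stable (coeff f e ≟𝔽 0#) (e≰ ∘ f≤b)

  -- A monomial order in which the i-th variable dominates, used to show
  -- that divisors of f ≉ 0 are supported in every box containing f.

  infix 4 _<ₗ_

  _<ₗ_ : ∀ {k} → Vec ℕ k → Vec ℕ k → Set
  []      <ₗ []      = ⊥
  (m ∷ d) <ₗ (n ∷ e) = m ℕ.< n ⊎ (m ≡ n × d <ₗ e)

  <ₗ-irrefl : ∀ {k} (d : Vec ℕ k) → ¬ d <ₗ d
  <ₗ-irrefl (m ∷ d) (inj₁ m<m)       = ℕₚ.<-irrefl ≡.refl m<m
  <ₗ-irrefl (m ∷ d) (inj₂ (_ , d<d)) = <ₗ-irrefl d d<d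

  <ₗ-trans : ∀ {k} (d e f : Vec ℕ k) → d <ₗ e → e <ₗ f → d <ₗ f
  <ₗ-trans [] [] [] () _
  <ₗ-trans (_ ∷ _) (_ ∷ _) (_ ∷ _) (inj₁ p) (inj₁ q) = inj₁ (ℕₚ.<-trans p q)
  <ₗ-trans (_ ∷ _) (_ ∷ _) (_ ∷ _) (inj₁ p) (inj₂ (≡.refl , _)) = inj₁ p
  <ₗ-trans (_ ∷ _) (_ ∷ _) (_ ∷ _) (inj₂ (≡.refl , _)) (inj₁ q) = inj₁ q
  <ₗ-trans (_ ∷ d) (_ ∷ e) (_ ∷ f) (inj₂ (≡.refl , p)) (inj₂ (≡.refl , q)) =
    inj₂ (≡.refl , <ₗ-trans d e f p q)

  <ₗ-total : ∀ {k} (d e : Vec ℕ k) → d <ₗ e ⊎ d ≡ e ⊎ e <ₗ d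
  <ₗ-total [] [] = inj₂ (inj₁ ≡.refl)
  <ₗ-total (m ∷ d) (n ∷ e) with ℕₚ.<-cmp m n
  ... | tri< m<n _ _ = inj₁ (inj₁ m<n)
  ... | tri> _ _ n<m = inj₂ (inj₂ (inj₁ n<m))
  ... | tri≈ _ ≡.refl _ with <ₗ-total d e
  ...   | inj₁ d<e           = inj₁ (inj₂ (≡.refl , d<e))
  ...   | inj₂ (inj₁ ≡.refl) = inj₂ (inj₁ ≡.refl)
  ...   | inj₂ (inj₂ e<d)    = inj₂ (inj₂ (inj₂ (≡.refl , e<d)))

  <-swap : ∀ a b m n → a ℕ.+ b ≡ m ℕ.+ n → a ℕ.< m → n ℕ.< b
  <-swap a b m n eq a<m = ℕₚ.≰⇒> λ b≤n → ℕₚ.<-irrefl eq (ℕₚ.+-mono-<-≤ a<m b≤n)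

  <ₗ-swap : ∀ {k} (a b d e : Vec ℕ k) → a +ₘ b ≡ d +ₘ e → a <ₗ d → e <ₗ b
  <ₗ-swap [] [] [] [] _ ()
  <ₗ-swap (i ∷ a) (j ∷ b) (m ∷ d) (n ∷ e) eq (inj₁ i<m) =
    inj₁ (<-swap i j m n (Vecₚ.∷-injectiveˡ eq) i<m)
  <ₗ-swap (i ∷ a) (j ∷ b) (m ∷ d) (n ∷ e) eq (inj₂ (≡.refl , a<d)) =
    inj₂ (≡.sym (ℕₚ.+-cancelˡ-≡ i j n (Vecₚ.∷-injectiveˡ eq))
         , <ₗ-swap a b d e (Vecₚ.∷-injectiveʳ eq) a<d)

  module Order {k : ℕ} (i : Fin k) where

    key : Monomial k → Vec ℕ (suc k)
    key e = lookup e i ∷ e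

    infix 4 _≺_

    _≺_ : Monomial k → Monomial k → Set
    d ≺ e = key d <ₗ key e

    ≺-total : ∀ d e → d ≺ e ⊎ d ≡ e ⊎ e ≺ d
    ≺-total d e with <ₗ-total (key d) (key e)
    ... | inj₁ d≺e        = inj₁ d≺e
    ... | inj₂ (inj₁ eq)  = inj₂ (inj₁ (Vecₚ.∷-injectiveʳ eq))
    ... | inj₂ (inj₂ e≺d) = inj₂ (inj₂ e≺d)

    ≺-swap : ∀ a b d e → a +ₘ b ≡ d +ₘ e → a ≺ d → e ≺ b
    ≺-swap a b d e eq = <ₗ-swap (key a) (key b) (key d) (key e) (≡.cong₂ _∷_ heads eq)
      where
      heads : lookup a i ℕ.+ lookup b i ≡ lookup d i ℕ.+ lookup e i
      heads = ≡.trans (≡.sym (Vecₚ.lookup-zipWith ℕ._+_ i a b))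
             (≡.trans (≡.cong (λ v → lookup v i) eq) (Vecₚ.lookup-zipWith ℕ._+_ i d e))

    ⊀⇒≤ : ∀ {d e} → ¬ d ≺ e → lookup e i ℕ.≤ lookup d i
    ⊀⇒≤ d⊀e = ℕₚ.≮⇒≥ (d⊀e ∘ inj₁)

    maximal : ∀ {e} xs → e ∈ xs → ∃ λ d → d ∈ xs × (∀ {e} → e ∈ xs → ¬ d ≺ e)
    maximal (x ∷ []) _ = x , here ≡.refl , λ { (here ≡.refl) → <ₗ-irrefl (key x) }
    maximal (x ∷ xs@(_ ∷ _)) _ with maximal xs (here ≡.refl)
    ... | d , d∈ , d-max with ≺-total d x
    ...   | inj₁ d≺x = x , here ≡.refl , λ
      { (here ≡.refl) → <ₗ-irrefl (key x)
      ; (there {x = _} e∈) x≺e → d-max e∈ (<ₗ-trans (key d) (key x) (key _) d≺x x≺e) }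
    ...   | inj₂ x⊁d = d , there d∈ , λ
      { (here ≡.refl) d≺x → case x⊁d of λ
          { (inj₁ ≡.refl) → <ₗ-irrefl (key x) d≺x
          ; (inj₂ x≺d)    → <ₗ-irrefl (key x) (<ₗ-trans (key x) (key d) (key x) x≺d d≺x) }
      ; (there e∈) → d-max e∈ }

    leading : ∀ (f : Poly k) → ¬ f ≈ₚ 0ₚ →
              ∃ λ d → ¬ coeff f d ≈𝔽 0# × (∀ {e} → d ≺ e → coeff f e ≈𝔽 0#)
    leading f f≉0 with _ , e∈ ← nonzero⇒support f f≉0 with maximal (support f) e∈
    ... | d , d∈ , d-max = d , ∈-support⁻ f d∈ , λ {e} d≺e →
      decidable-stable (coeff f e ≟𝔽 0#) λ fe≉0 → d-max (∈-support⁺ f fe≉0) d≺e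

  +-∸ : ∀ {k} (d a : Monomial k) → a ≤ₘ d → a +ₘ (d ∸ₘ a) ≡ d
  +-∸ []      []      []          = ≡.refl
  +-∸ (n ∷ d) (i ∷ a) (i≤n ∷ a≤d) = ≡.cong₂ _∷_ (ℕₚ.m+[n∸m]≡n i≤n) (+-∸ d a a≤d)

  ∸-+ : ∀ {k} (d e : Monomial k) → (d +ₘ e) ∸ₘ d ≡ e
  ∸-+ []      []      = ≡.refl
  ∸-+ (m ∷ d) (n ∷ e) = ≡.cong₂ _∷_ (ℕₚ.m+n∸m≡n m n) (∸-+ d e)

  ≤-+ : ∀ {k} (d e : Monomial k) → d ≤ₘ d +ₘ e
  ≤-+ []      []      = []
  ≤-+ (m ∷ d) (n ∷ e) = ℕₚ.m≤m+n m n ∷ ≤-+ d e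

  sum-single : {A : Set} {xs : List A} {x : A} (h : A → 𝔽) → Unique≡ xs → x ∈ xs →
               (∀ {y} → y ∈ xs → ¬ y ≡ x → h y ≈𝔽 0#) → sumOver xs h ≈𝔽 h x
  sum-single {xs = z ∷ xs} h (z∉ ∷ u) (here ≡.refl) h≈0 =
    trans (+-congˡ (sum-zero xs λ y∈ → h≈0 (there y∈) λ { ≡.refl → All.lookup z∉ y∈ ≡.refl }))
          (+-identityʳ _)
  sum-single {xs = z ∷ xs} h (z∉ ∷ u) (there x∈) h≈0 =
    trans (+-cong (h≈0 (here ≡.refl) (All.lookup z∉ x∈)) (sum-single h u x∈ (h≈0 ∘ there)))
          (+-identityˡ _)

  *ₚ-factors : ∀ {k} (f g : Poly k) → ¬ f *ₚ g ≈ₚ 0ₚ → ¬ f ≈ₚ 0ₚ × ¬ g ≈ₚ 0ₚ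
  *ₚ-factors f g fg≉0 =
    (λ f≈0 → fg≉0 λ e → sum-zero (box e) λ {a} _ → trans (*-congʳ (f≈0 a)) (zeroˡ _)) ,
    (λ g≈0 → fg≉0 λ e → sum-zero (box e) λ {a} _ → trans (*-congˡ (g≈0 (e ∸ₘ a))) (zeroʳ _))

  module _ {k} (i : Fin k) (f g : Poly k) (f≉0 : ¬ f ≈ₚ 0ₚ) (g≉0 : ¬ g ≈ₚ 0ₚ) where
    open Order i

    leading-* : ∃ λ d → ∃ λ e → ¬ coeff (f *ₚ g) (d +ₘ e) ≈𝔽 0#
                × (∀ {a} → ¬ coeff f a ≈𝔽 0# → lookup a i ℕ.≤ lookup d i)
                × (∀ {a} → ¬ coeff g a ≈𝔽 0# → lookup a i ℕ.≤ lookup e i)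
    leading-* with leading f f≉0 | leading g g≉0
    ... | d , fd≉0 , f-lead | e , ge≉0 , g-lead =
      d , e
      , (λ fg≈0 → *-nonzero fd≉0 ge≉0 (trans (sym top) fg≈0))
      , (λ fa≉0 → ⊀⇒≤ (fa≉0 ∘ f-lead))
      , (λ ga≉0 → ⊀⇒≤ (ga≉0 ∘ g-lead))
      where
      h : Monomial k → 𝔽
      h a = coeff f a * coeff g ((d +ₘ e) ∸ₘ a)

      others : ∀ {a} → a ∈ box (d +ₘ e) → ¬ a ≡ d → h a ≈𝔽 0#
      others {a} a∈ a≢d with ≺-total a d
      ... | inj₁ a≺d = trans (*-congˡ (g-lead (≺-swap a _ d e (+-∸ (d +ₘ e) a (∈-box⁻ _ a∈)) a≺d))) (zeroʳ _)
      ... | inj₂ (inj₁ a≡d) = contradiction a≡d a≢d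
      ... | inj₂ (inj₂ d≺a) = trans (*-congʳ (f-lead d≺a)) (zeroˡ _)

      top : coeff (f *ₚ g) (d +ₘ e) ≈𝔽 coeff f d * coeff g e
      top = trans (sum-single h (box-unique (d +ₘ e)) (∈-box⁺ (≤-+ d e)) others)
                  (reflexive (≡.cong (λ v → coeff f d * coeff g v) (∸-+ d e)))

  factors-bounded : ∀ {k} (f g h : Poly k) → ¬ h ≈ₚ 0ₚ → f *ₚ g ≈ₚ h →
                    (∀ {a} → ¬ coeff f a ≈𝔽 0# → a ≤ₘ bound h) ×
                    (∀ {a} → ¬ coeff g a ≈𝔽 0# → a ≤ₘ bound h)
  factors-bounded f g h h≉0 fg≈h =
    (λ {a} fa≉0 → lookup⇒≤ₘ a (bound h) λ i →
      let d , e , fg≉ , f≤ , _ = leading-* i f g f≉0 g≉0 in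
      ℕₚ.≤-trans (f≤ fa≉0) (ℕₚ.≤-trans (ℕₚ.m≤m+n _ _) (≤bound i d e fg≉))) ,
    (λ {a} ga≉0 → lookup⇒≤ₘ a (bound h) λ i →
      let d , e , fg≉ , _ , g≤ = leading-* i f g f≉0 g≉0 in
      ℕₚ.≤-trans (g≤ ga≉0) (ℕₚ.≤-trans (ℕₚ.m≤n+m _ _) (≤bound i d e fg≉)))
    where
    factors≉0 = *ₚ-factors f g (λ fg≈0 → h≉0 λ e → trans (sym (fg≈h e)) (fg≈0 e))
    f≉0 = proj₁ factors≉0
    g≉0 = proj₂ factors≉0
    ≤bound : ∀ i d e → ¬ coeff (f *ₚ g) (d +ₘ e) ≈𝔽 0# →
             lookup d i ℕ.+ lookup e i ℕ.≤ lookup (bound h) i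
    ≤bound i d e fg≉ = ℕₚ.≤-trans
      (ℕₚ.≤-reflexive (≡.sym (Vecₚ.lookup-zipWith ℕ._+_ i d e)))
      (Pointwise.lookup (≤ₘ-bound h (fg≉ ∘ trans (fg≈h (d +ₘ e)))) i)

  *ₚ-cong : ∀ {k} (f f′ g g′ : Poly k) → f ≈ₚ f′ → g ≈ₚ g′ → f *ₚ g ≈ₚ f′ *ₚ g′
  *ₚ-cong f f′ g g′ f≈f′ g≈g′ e = sum-cong (box e) λ a → *-cong (f≈f′ a) (g≈g′ (e ∸ₘ a))

  ∣-respˡ : ∀ {k} (f g h : Poly k) → f ≈ₚ g → f ∣ h → g ∣ h
  ∣-respˡ f g h f≈g (q , qf≈h) =
    q , λ e → trans (*ₚ-cong q q g f (λ _ → refl) (λ a → sym (f≈g a)) e) (qf≈h e)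

  ∣-dec : ∀ {k} (f h : Poly k) → ¬ h ≈ₚ 0ₚ → Dec (f ∣ h)
  ∣-dec f h h≉0 = Dec.map′
    (λ any → let q , qf≈h = Any.satisfied any in q , qf≈h)
    (λ (q , qf≈h) → Any.map
      (λ {q′} q≈q′ → λ e → trans (*ₚ-cong q′ q f f (λ a → sym (q≈q′ a)) (λ _ → refl) e) (qf≈h e))
      (boxPolys-complete (bound h) q (proj₁ (factors-bounded q f h h≉0 qf≈h))))
    (Any.any? (λ q → q *ₚ f ≟ₚ h) (boxPolys (bound h)))

  term-coeff : ∀ {k} x (e : Monomial k) → coeff (term x e) e ≡ x
  term-coeff x e with e ≟ₘ e
  ... | yes _  = ≡.refl
  ... | no e≢e = contradiction ≡.refl e≢e

  term-nonzero : ∀ {k} {x} (e : Monomial k) → ¬ x ≈𝔽 0# → ¬ term x e ≈ₚ 0ₚ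
  term-nonzero {x = x} e x≉0 t≈0 = x≉0 (trans (sym (reflexive (term-coeff x e))) (t≈0 e))

  coprime? : ∀ {k} (f g : Poly k) → ¬ f ≈ₚ 0ₚ → ¬ g ≈ₚ 0ₚ → Dec (Coprime f g)
  coprime? {k} f g f≉0 g≉0 = Dec.map′ to from (All.all? test (boxPolys (bound f)))
    where
    Test : Poly k → Set (c ⊔ ℓ)
    Test d = d ∣ f → d ∣ g → d ∣ 1ₚ
    test : Decidable Test
    test d = ∣-dec d f f≉0 →-dec ∣-dec d g g≉0 →-dec ∣-dec d 1ₚ (term-nonzero (replicate k 0) nontrivial)
    to : All Test (boxPolys (bound f)) → Coprime f g
    to all {z} z∣f@(q , qz≈f) z∣g
      with find (boxPolys-complete (bound f) z (proj₂ (factors-bounded q z f f≉0 qz≈f)))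
    ... | d , d∈ , z≈d =
      ∣-respˡ d z 1ₚ (λ e → sym (z≈d e))
        (All.lookup all d∈ (∣-respˡ z d f z≈d z∣f) (∣-respˡ z d g z≈d z∣g))
    from : Coprime f g → All Test (boxPolys (bound f))
    from cop = All.universal (λ d d∣f d∣g → cop d∣f d∣g) _

  ·-*ₚ : ∀ {k} x (f g : Poly k) → (x ·ₚ f) *ₚ g ≈ₚ x ·ₚ (f *ₚ g)
  ·-*ₚ x f g e = go (box e)
    where
    go : ∀ as → sumOver as (λ a → x * coeff f a * coeff g (e ∸ₘ a)) ≈𝔽
                x * sumOver as (λ a → coeff f a * coeff g (e ∸ₘ a))
    go []       = sym (zeroʳ x)
    go (a ∷ as) = trans (+-cong (*-assoc x _ _) (go as)) (sym (distribˡ x _ _))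

  ∣-resp-∼ : ∀ {k} (z f g : Poly k) → f ∼ g → z ∣ f → z ∣ g
  ∣-resp-∼ z f g (x , _ , xf≈g) (q , qz≈f) =
    x ·ₚ q , λ e → trans (·-*ₚ x q z e) (trans (*-congˡ (qz≈f e)) (xf≈g e))

  Coprime-resp : ∀ {k} (f f′ g g′ : Poly k) → f ∼ f′ → g ∼ g′ → Coprime f g → Coprime f′ g′
  Coprime-resp f f′ g g′ f∼f′ g∼g′ cop {z} z∣f′ z∣g′ =
    cop (∣-resp-∼ z f′ f (∼-sym f f′ f∼f′) z∣f′) (∣-resp-∼ z g′ g (∼-sym g g′ g∼g′) z∣g′)

  HasDeg? : ∀ {k} (m : Vec ℕ k) → Decidable (HasDeg m)
  HasDeg? m f = ¬? (f ≟ₚ 0ₚ) ×-dec (Deg f ≟ₘ m)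

  𝒩-decSetoid : ∀ {k} → Vec ℕ k → DecSetoid (c ⊔ ℓ) (c ⊔ ℓ)
  𝒩-decSetoid m = record
    { isDecEquivalence = record
      { isEquivalence = Setoid.isEquivalence (𝒩 m)
      ; _≟_           = λ (f , _) (g , _) → f ∼? g
      }
    }

  𝒩-finite : ∀ {k} (m : Vec ℕ k) → Finite (𝒩 m)
  𝒩-finite m = enumeration⇒Finite (𝒩-decSetoid m) (sieve (HasDeg? m) (boxPolys m))
    λ (f , f≉0 , deg) → Any.map (λ {(g , _)} → ∼-reflexive f g)
      (sieve⁺ (HasDeg? m) (λ {g} f≈g → HasDeg-resp f g f≈g (f≉0 , deg))
        (boxPolys-complete m f (λ fe≉0 → ≡.subst (_ ≤ₘ_) deg (≤ₘ-Deg f fe≉0))))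

  𝒫-finite : ∀ {k} (m n : Vec ℕ k) → Finite (𝒫 m n)
  𝒫-finite m n = enumeration⇒Finite
    (On.decSetoid (×-decSetoid (𝒩-decSetoid m) (𝒩-decSetoid n)) proj₁)
    (sieve coprimePair? (cartesianProduct (elements (𝒩-finite m)) (elements (𝒩-finite n))))
    λ (fg@((f , _) , (g , _)) , cop) → sieve⁺ coprimePair?
      (λ {((f′ , _) , (g′ , _))} (f∼f′ , g∼g′) → Coprime-resp f f′ g g′ f∼f′ g∼g′ cop)
      (Enumeratesₚ.cartesianProduct⁺ (𝒩 m) (𝒩 n) (complete (𝒩-finite m)) (complete (𝒩-finite n)) fg)
    where
    open Finite
    coprimePair? : Decidable (CoprimePair m n)
    coprimePair? ((f , f≉0 , _) , (g , g≉0 , _)) = coprime? f g f≉0 g≉0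

  N : ∀ {k} → Vec ℕ k → ℕ
  N m = Finite.card (𝒩-finite m)

  P : ∀ {k} → Vec ℕ k → Vec ℕ k → ℕ
  P m n = Finite.card (𝒫-finite m n)

  term-HasDeg : ∀ {k} (m : Vec ℕ k) → HasDeg m (term 1# m)
  term-HasDeg m = term-nonzero m nontrivial ,
    ≡.trans (Vecₚ.tabulate-cong deg) (Vecₚ.tabulate∘lookup m)
    where
    t = term 1# m
    tm≉0 : ¬ coeff t m ≈𝔽 0#
    tm≉0 tm≈0 = nontrivial (trans (sym (reflexive (term-coeff 1# m))) tm≈0)
    deg : ∀ i → degree i t ≡ lookup m i
    deg i = ℕₚ.≤-antisym
      (degree-≤ t i (λ te≉0 → Pointwise.lookup (≤ₘ-bound t te≉0) i))
      (≤-degree t i tm≉0)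

  N-nonZero : ∀ {k} (m : Vec ℕ k) → ℕ.NonZero (N m)
  N-nonZero m = ℕ.>-nonZero
    (SetoidMembershipₚ.∈-length (𝒩 m) {x = xᵐ} (Finite.complete (𝒩-finite m) xᵐ))
    where
    xᵐ : Setoid.Carrier (𝒩 m)
    xᵐ = term 1# m , term-HasDeg m

  coprimeRatio : ∀ {k} → Vec ℕ k → Vec ℕ k → ℚ
  coprimeRatio m n = (ℤ.+ P m n / (N m ℕ.* N n))
    ⦃ ℕₚ.m*n≢0 (N m) (N n) ⦃ N-nonZero m ⦄ ⦃ N-nonZero n ⦄ ⦄

{-# OPTIONS --safe #-}

-- If f and g of degrees m and n are not coprime, then (f, g) = (r z, s z) with
-- a = Deg z ≠ 0 and a ≤ m, n.  A box of volume V = ∏ (eᵢ + 1) carries q^V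
-- polynomials, so at most q^(V(a) + V(m - a) + V(n - a)) pairs arise from a given a,
-- whereas N m ≥ q^(V(m) - 1) by counting polynomials with xᵐ-coefficient 1.  Now
-- V(a) + V(n - a) ≤ V(n) + 1, and V(m) - V(m - a) ≥ L |a| as soon as the last two
-- coordinates of m are at least 2 L.  Hence the proportion of non-coprime pairs is
-- at most q³ Σ_{a ≠ 0} q^(-L |a|), uniformly in n, which tends to 0 as L → ∞.

module Submission where

open import Defs
open import Data.Nat using (ℕ; _≤_; _+_)
open import Data.Product using (∃-syntax)
open import Data.Rational using (ℚ; 0ℚ; 1ℚ; ∣_∣; _-_; _<_)
open import Data.Vec using (Vec; init; last)

open import Algebra.Bundles using (CommutativeRing)
open import Algebra.Definitions.RawMagma using (_,_)
open import Data.Fin using (Fin; zero; suc)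
import Data.Fin.Properties as Finₚ
import Data.Integer as ℤ
import Data.Integer.Properties as ℤₚ
open import Data.List using (List; []; _∷_; _++_; length; map; upTo; applyUpTo; cartesianProduct; cartesianProductWith; concatMap)
import Data.List as List
open import Data.List.Membership.Propositional using (lose)
open import Data.List.Membership.Propositional.Properties using (∈-lookup)
import Data.List.Properties as Listₚ
open import Data.List.Relation.Unary.All as All using ([]; _∷_)
open import Data.List.Relation.Unary.AllPairs using ([]; _∷_)
open import Data.List.Relation.Unary.Any as Any using (Any; here; there)
import Data.List.Relation.Unary.Any.Properties as Anyₚ
open import Data.List.Relation.Unary.Unique.Propositional using () renaming (Unique to Unique≡)
import Data.List.Relation.Unary.Unique.Setoid as UniqueSetoid
import Data.List.Relation.Unary.Unique.Setoid.Properties as UniqueSetoidₚ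
open import Data.Nat using (zero; suc; _*_; _^_; _∸_; z≤n; s≤s; NonZero)
import Data.Nat as ℕ
open import Data.Nat.ListAction using (sum)
open import Data.Nat.ListAction.Properties using (sum-++)
open import Data.Nat.Properties
open import Data.Nat.Tactic.RingSolver using (solve-∀)
open import Data.Product using (_×_; _,_; proj₁; proj₂)
open import Data.Product.Relation.Binary.Pointwise.NonDependent using (_×ₛ_)
import Data.Rational as ℚ
import Data.Rational.Properties as ℚₚ
import Data.Rational.Unnormalised as ℚᵘ
import Data.Rational.Unnormalised.Properties as ℚᵘₚ
open import Data.Vec using ([]; _∷_; lookup; replicate; zipWith)
import Data.Vec as Vec
import Data.Vec.Properties as Vecₚ
open import Data.Vec.Relation.Binary.Pointwise.Inductive as Pointwise using ([]; _∷_)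
open import Function using (_∘_; _⟨_⟩_)
open import Relation.Binary using (Setoid)
open import Relation.Binary.PropositionalEquality using (_≡_; refl; sym; trans; cong; cong₂; subst; subst₂; module ≡-Reasoning)
import Relation.Binary.Reasoning.Setoid as SetoidReasoning
open import Relation.Nullary using (¬_; yes; no; contradiction)
open import Relation.Nullary.Decidable using (_×-dec_; decidable-stable)

-- The pigeonhole principle and sums over lists.

module _ {a ℓ} (S : Setoid a ℓ) where
  open Setoid S using (Carrier; _≈_) renaming (sym to ≈-sym)
  open UniqueSetoid S using (Unique)

  lookup-injective : ∀ {xs} → Unique xs → ∀ i j → List.lookup xs i ≈ List.lookup xs j → i ≡ j
  lookup-injective (_ ∷ _)  zero    zero    _  = refl
  lookup-injective (x∉ ∷ _) zero    (suc j) eq = contradiction eq (All.lookup x∉ (∈-lookup j))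
  lookup-injective (x∉ ∷ _) (suc i) zero    eq = contradiction (≈-sym eq) (All.lookup x∉ (∈-lookup i))
  lookup-injective (_ ∷ u)  (suc i) (suc j) eq = cong suc (lookup-injective u i j eq)

  -- Each position of `xs` is sent to the position in `ys` that `cover` exhibits, and two positions
  -- sharing an entry hold equivalent elements. Working with a relation allows classes to be counted
  -- against a plain list without choosing representatives.
  pigeonhole : ∀ {b r} {B : Set b} {xs} {ys : List B} (R : Carrier → B → Set r) → Unique xs →
               (∀ x → Any (R x) ys) →
               (∀ {x x′ y} → R x y → R x′ y → x ≈ x′) →
               length xs ≤ length ys
  pigeonhole {xs = xs} {ys} R u cover inj = Finₚ.injective⇒≤ {f = hole} λ {i} {j} eq →
    lookup-injective u i j (inj (Anyₚ.lookup-index (cover (List.lookup xs i)))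
      (subst (λ h → R (List.lookup xs j) (List.lookup ys h)) (sym eq)
        (Anyₚ.lookup-index (cover (List.lookup xs j)))))
    where
    hole : Fin (length xs) → Fin (length ys)
    hole i = Any.index (cover (List.lookup xs i))

module _ {a b c} {A : Set a} {B : Set b} {C : Set c} where

  length-cartesianProductWith : ∀ (f : A → B → C) xs ys →
    length (cartesianProductWith f xs ys) ≡ length xs * length ys
  length-cartesianProductWith f []       ys = refl
  length-cartesianProductWith f (x ∷ xs) ys = trans (Listₚ.length-++ (map (f x) ys))
    (cong₂ _+_ (Listₚ.length-map (f x) ys) (length-cartesianProductWith f xs ys))

  sum-cartesianProductWith : ∀ (t : C → ℕ) (f : A → B → C) xs ys →
    sum (map t (cartesianProductWith f xs ys)) ≡ sum (map (λ x → sum (map (t ∘ f x) ys)) xs)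
  sum-cartesianProductWith t f []       ys = refl
  sum-cartesianProductWith t f (x ∷ xs) ys = trans
    (cong sum (Listₚ.map-++ t (map (f x) ys) _))
    (trans (sum-++ (map t (map (f x) ys)) _)
      (cong₂ _+_ (cong sum (sym (Listₚ.map-∘ ys))) (sum-cartesianProductWith t f xs ys)))

module _ {a b} {A : Set a} {B : Set b} where

  length-concatMap : ∀ (f : A → List B) xs → length (concatMap f xs) ≡ sum (map (length ∘ f) xs)
  length-concatMap f []       = refl
  length-concatMap f (x ∷ xs) = trans (Listₚ.length-++ (f x)) (cong (length (f x) +_) (length-concatMap f xs))

module _ {a} {A : Set a} where

  *-distribˡ-sum : ∀ c (t : A → ℕ) xs → c * sum (map t xs) ≡ sum (map (λ x → c * t x) xs)
  *-distribˡ-sum c t []       = *-zeroʳ c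
  *-distribˡ-sum c t (x ∷ xs) = trans (*-distribˡ-+ c (t x) _) (cong (c * t x +_) (*-distribˡ-sum c t xs))

-- Geometric sums.

n≤2^n : ∀ n → n ≤ 2 ^ n
n≤2^n zero    = z≤n
n≤2^n (suc n) = ≤-trans (+-mono-≤ (m^n>0 2 n) (n≤2^n n))
  (≤-reflexive (cong (2 ^ n +_) (sym (+-identityʳ (2 ^ n)))))

-- This is the bound 1 + 1/2 + 1/4 + ... ≤ 2 without fractions. The doubled tail satisfies the
-- hypothesis with the same `K`, so by induction the tail is at most `K`, as is `s 0`.
geometric-sum-≤ : ∀ (s : ℕ → ℕ) n {K} → (∀ i → i ℕ.< n → 2 ^ i * s i ≤ K) → sum (applyUpTo s n) ≤ 2 * K
geometric-sum-≤ s zero    h = z≤n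
geometric-sum-≤ s (suc n) {K} h = begin
  s 0 + sum (applyUpTo (s ∘ suc) n)  ≤⟨ +-mono-≤ s₀≤K rest ⟩
  K + K                              ≡⟨ cong (K +_) (+-identityʳ K) ⟨
  2 * K                              ∎
  where
  open ≤-Reasoning
  s₀≤K : s 0 ≤ K
  s₀≤K = subst (_≤ K) (*-identityˡ (s 0)) (h 0 (s≤s z≤n))
  doubled : sum (applyUpTo (λ i → 2 * s (suc i)) n) ≤ 2 * K
  doubled = geometric-sum-≤ (λ i → 2 * s (suc i)) n λ i i<n →
    subst (_≤ K) (shift (2 ^ i) (s (suc i))) (h (suc i) (s≤s i<n))
    where
    shift : ∀ p x → 2 * p * x ≡ p * (2 * x)
    shift = solve-∀
  rest : sum (applyUpTo (s ∘ suc) n) ≤ K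
  rest = *-cancelˡ-≤ 2 (begin
    2 * sum (applyUpTo (s ∘ suc) n)             ≡⟨ cong (λ xs → 2 * sum xs) (Listₚ.map-upTo (s ∘ suc) n) ⟨
    2 * sum (map (s ∘ suc) (upTo n))            ≡⟨ *-distribˡ-sum 2 (s ∘ suc) (upTo n) ⟩
    sum (map (λ i → 2 * s (suc i)) (upTo n))    ≡⟨ cong sum (Listₚ.map-upTo (λ i → 2 * s (suc i)) n) ⟩
    sum (applyUpTo (λ i → 2 * s (suc i)) n)     ≤⟨ doubled ⟩
    2 * K                                       ∎)

-- Volumes of boxes.

volume : ∀ {k} → Monomial k → ℕ
volume []      = 1
volume (n ∷ e) = suc n * volume e

length-box : ∀ {k} (e : Monomial k) → length (box e) ≡ volume e
length-box []      = refl
length-box (n ∷ e) = trans (length-cartesianProductWith _∷_ (upTo (suc n)) (box e))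
  (cong₂ _*_ (Listₚ.length-upTo (suc n)) (length-box e))

infixl 6 _∸ᵛ_

_∸ᵛ_ : ∀ {k} → Monomial k → Monomial k → Monomial k
_∸ᵛ_ = zipWith _∸_

volume-mono : ∀ {k} {d e : Monomial k} → d ≤ₘ e → volume d ≤ volume e
volume-mono []          = ≤-refl
volume-mono (i≤n ∷ d≤e) = *-mono-≤ (s≤s i≤n) (volume-mono d≤e)

∸ᵛ-≤ : ∀ {k} (d a : Monomial k) → d ∸ᵛ a ≤ₘ d
∸ᵛ-≤ []      []      = []
∸ᵛ-≤ (n ∷ d) (i ∷ a) = m∸n≤m n i ∷ ∸ᵛ-≤ d a

-- The boxes [0, a] and [a, n] meet in the single point a.
volume-superadditive : ∀ {k} {a n : Monomial k} → a ≤ₘ n → volume a + volume (n ∸ᵛ a) ≤ suc (volume n)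
volume-superadditive [] = ≤-refl
volume-superadditive {a = i ∷ a} {n ∷ e} (i≤n ∷ a≤e) = begin
  (x + i * x) + (y + j * y)  ≡⟨ rearrange i j x y ⟩
  (x + y) + (i * x + j * y)  ≤⟨ +-mono-≤ (volume-superadditive a≤e)
                                 (+-mono-≤ (*-monoʳ-≤ i (volume-mono a≤e)) (*-monoʳ-≤ j (volume-mono (∸ᵛ-≤ e a)))) ⟩
  suc z + (i * z + j * z)    ≡⟨ cong (suc z +_) (*-distribʳ-+ z i j) ⟨
  suc z + (i + j) * z        ≡⟨ cong (λ t → suc z + t * z) (m+[n∸m]≡n i≤n) ⟩
  suc (z + n * z)            ∎
  where
  open ≤-Reasoning
  x = volume a
  y = volume (e ∸ᵛ a)
  z = volume e
  j = n ∸ i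
  rearrange : ∀ i j x y → (x + i * x) + (y + j * y) ≡ (x + y) + (i * x + j * y)
  rearrange = solve-∀

-- Provides `L ≤ volume m` in the induction step of `volume-gap`.
last≤volume : ∀ {k} (m : Monomial (suc k)) → last m ≤ volume m
last≤volume (n ∷ [])    = ≤-trans (n≤1+n n) (≤-reflexive (sym (*-identityʳ (suc n))))
last≤volume (n ∷ i ∷ m) = ≤-trans (last≤volume (i ∷ m)) (m≤m+n _ _)

-- Shrinking the rectangle removes a strip of width `a` and one of width `c`, with areas at least
-- `a * (c + d)` and `c * (a + b)`. The strips overlap, but twice their union is at least the sum of
-- their areas, hence at least `2 * L * (a + c)`; this is why the sides are compared with `2 * L`.
rectangle-gap : ∀ L a b c d → 2 * L ≤ a + b → 2 * L ≤ c + d →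
                suc b * suc d + L * (a + c) ≤ suc (a + b) * suc (c + d)
rectangle-gap L a b c d 2L≤a+b 2L≤c+d = *-cancelˡ-≤ 2 (begin
  2 * (suc b * suc d + L * (a + c))                              ≡⟨ expand L a b c d ⟩
  2 * (suc b * suc d) + (2 * L * a + 2 * L * c)                  ≤⟨ +-monoʳ-≤ (2 * (suc b * suc d))
                                                                     (+-mono-≤ (*-monoˡ-≤ a 2L≤c+d) (*-monoˡ-≤ c 2L≤a+b)) ⟩
  2 * (suc b * suc d) + ((c + d) * a + (a + b) * c)              ≤⟨ m≤m+n _ (a * d + 2 * a + b * c + 2 * c) ⟩
  2 * (suc b * suc d) + ((c + d) * a + (a + b) * c) + (a * d + 2 * a + b * c + 2 * c)
                                                                 ≡⟨ collect a b c d ⟩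
  2 * (suc (a + b) * suc (c + d))                                ∎)
  where
  open ≤-Reasoning
  expand : ∀ L a b c d → 2 * ((1 + b) * (1 + d) + L * (a + c)) ≡ 2 * ((1 + b) * (1 + d)) + (2 * L * a + 2 * L * c)
  expand = solve-∀
  collect : ∀ a b c d → 2 * ((1 + b) * (1 + d)) + ((c + d) * a + (a + b) * c) + (a * d + 2 * a + b * c + 2 * c) ≡
                        2 * ((1 + (a + b)) * (1 + (c + d)))
  collect = solve-∀

-- The last two coordinates form the rectangle of `rectangle-gap`. A further coordinate stacks
-- `suc n` layers of volume `v`: one gains the gap by induction, `i` are removed entirely and are
-- worth `v ≥ L` each, and the other `n ∸ i` do not grow.
volume-gap : ∀ {k} L (m a : Monomial (2 + k)) → 2 * L ≤ last (init m) → 2 * L ≤ last m → a ≤ₘ m →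
             volume (m ∸ᵛ a) + L * Vec.sum a ≤ volume m
volume-gap L (m₁ ∷ m₂ ∷ []) (a₁ ∷ a₂ ∷ []) 2L≤m₁ 2L≤m₂ (a₁≤m₁ ∷ a₂≤m₂ ∷ []) =
  subst₂ _≤_
    (cong₂ (λ x y → suc (m₁ ∸ a₁) * x + L * (a₁ + y)) (sym (*-identityʳ (suc (m₂ ∸ a₂)))) (sym (+-identityʳ a₂)))
    (cong₂ (λ x y → suc x * y) eq₁ (trans (cong suc eq₂) (sym (*-identityʳ (suc m₂)))))
    (rectangle-gap L a₁ (m₁ ∸ a₁) a₂ (m₂ ∸ a₂)
      (subst (2 * L ≤_) (sym eq₁) 2L≤m₁) (subst (2 * L ≤_) (sym eq₂) 2L≤m₂))
  where
  eq₁ = m+[n∸m]≡n a₁≤m₁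
  eq₂ = m+[n∸m]≡n a₂≤m₂
volume-gap {suc k} L (n ∷ m@(_ ∷ _)) (i ∷ a) 2L≤ 2L≤last (i≤n ∷ a≤m) = begin
  (w + j * w) + L * (i + s)      ≡⟨ rearrange L i j s w ⟩
  (w + L * s) + (i * L + j * w)  ≤⟨ +-mono-≤ (volume-gap L m a 2L≤ 2L≤last a≤m)
                                     (+-mono-≤ (*-monoʳ-≤ i L≤v) (*-monoʳ-≤ j (volume-mono (∸ᵛ-≤ m a)))) ⟩
  v + (i * v + j * v)            ≡⟨ cong (v +_) (*-distribʳ-+ v i j) ⟨
  v + (i + j) * v                ≡⟨ cong (λ t → v + t * v) (m+[n∸m]≡n i≤n) ⟩
  v + n * v                      ∎
  where
  open ≤-Reasoning
  v = volume m
  w = volume (m ∸ᵛ a)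
  j = n ∸ i
  s = Vec.sum a
  L≤v : L ≤ v
  L≤v = ≤-trans (m≤m+n L _) (≤-trans 2L≤last (last≤volume m))
  rearrange : ∀ L i j s w → (w + j * w) + L * (i + s) ≡ (w + L * s) + (i * L + j * w)
  rearrange = solve-∀

-- Applies `geometric-sum-≤` one coordinate at a time, each costing a factor 2. The constant `2 ^ k`
-- does not depend on the size of the box.
box-sum-≤ : ∀ {k} (m : Monomial k) (t : Monomial k → ℕ) {K} →
            (∀ a → a ≤ₘ m → 2 ^ Vec.sum a * t a ≤ K) → sum (map t (box m)) ≤ 2 ^ k * K
box-sum-≤ []      t {K} h = begin
  t [] + 0      ≡⟨ +-comm (t []) 0 ⟩
  t []          ≡⟨ *-identityˡ (t []) ⟨
  1 * t []      ≤⟨ h [] [] ⟩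
  K             ≡⟨ *-identityˡ K ⟨
  1 * K         ∎
  where open ≤-Reasoning
box-sum-≤ {suc k} (n ∷ m) t {K} h = begin
  sum (map t (box (n ∷ m)))          ≡⟨ sum-cartesianProductWith t _∷_ (upTo (suc n)) (box m) ⟩
  sum (map slice (upTo (suc n)))     ≡⟨ cong sum (Listₚ.map-upTo slice (suc n)) ⟩
  sum (applyUpTo slice (suc n))      ≤⟨ geometric-sum-≤ slice (suc n) slice-≤ ⟩
  2 * (2 ^ k * K)                    ≡⟨ *-assoc 2 (2 ^ k) K ⟨
  2 ^ suc k * K                      ∎
  where
  open ≤-Reasoning
  slice : ℕ → ℕ
  slice i = sum (map (t ∘ (i ∷_)) (box m))
  slice-≤ : ∀ i → i ℕ.< suc n → 2 ^ i * slice i ≤ 2 ^ k * K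
  slice-≤ i i<1+n = begin
    2 ^ i * slice i                                   ≡⟨ *-distribˡ-sum (2 ^ i) (t ∘ (i ∷_)) (box m) ⟩
    sum (map (λ a → 2 ^ i * t (i ∷ a)) (box m))       ≤⟨ box-sum-≤ m (λ a → 2 ^ i * t (i ∷ a)) (λ a a≤m → begin
      2 ^ Vec.sum a * (2 ^ i * t (i ∷ a))               ≡⟨ swap (2 ^ Vec.sum a) (2 ^ i) (t (i ∷ a)) ⟩
      2 ^ i * 2 ^ Vec.sum a * t (i ∷ a)                 ≡⟨ cong (_* t (i ∷ a)) (^-distribˡ-+-* 2 i (Vec.sum a)) ⟨
      2 ^ Vec.sum (i ∷ a) * t (i ∷ a)                   ≤⟨ h (i ∷ a) (≤-pred i<1+n ∷ a≤m) ⟩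
      K                                                 ∎) ⟩
    2 ^ k * K                                         ∎
    where
    swap : ∀ x y z → x * (y * z) ≡ y * x * z
    swap = solve-∀

-- From natural numbers to the rational ratio.

-- The numerator of ε is at least 1, so ε ≥ 1 / ↧ₙ ε.
ratio-near-1 : ∀ P T .{{_ : NonZero T}} ε → 0ℚ < ε → P ≤ T → ℚ.↧ₙ ε * (T ∸ P) ℕ.< T →
               ∣ (ℤ.+ P ℚ./ T) - 1ℚ ∣ < ε
ratio-near-1 P T@(suc t) ε@(ℚ.mkℚ (ℤ.+ suc u) d _) _ P≤T small = ℚₚ.toℚᵘ-cancel-<
  (ℚᵘₚ.<-respˡ-≃ (ℚᵘₚ.≃-sym lhs) (ℚᵘ.*<* (subst₂ ℤ._<_ (ℤₚ.pos-* r (suc d)) (ℤₚ.pos-* (suc u) T)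
    (ℤ.+<+ (begin-strict
      r * suc d       ≡⟨ *-comm r (suc d) ⟩
      suc d * r       <⟨ small ⟩
      T               ≤⟨ m≤m+n T (u * T) ⟩
      suc u * T       ∎)))))
  where
  open ≤-Reasoning
  r = T ∸ P
  lhs : ℚ.toℚᵘ ∣ (ℤ.+ P ℚ./ T) - 1ℚ ∣ ℚᵘ.≃ ℚᵘ.mkℚᵘ (ℤ.+ r) t
  lhs = ℚᵘₚ.≃-trans (ℚₚ.toℚᵘ-homo-∣-∣ ((ℤ.+ P ℚ./ T) - 1ℚ))
       (ℚᵘₚ.∣-∣-cong (ℚᵘₚ.≃-trans (ℚₚ.toℚᵘ-homo-+ (ℤ.+ P ℚ./ T) (ℚ.- 1ℚ))
         (ℚᵘₚ.+-congˡ (ℚᵘ.- ℚᵘ.1ℚᵘ) (ℚₚ.toℚᵘ-fromℚᵘ (ℚᵘ.mkℚᵘ (ℤ.+ P) t))))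
       ⟨ ℚᵘₚ.≃-trans ⟩ ℚᵘ.*≡* (cong₂ (λ x y → ℤ.+ x ℤ.* ℤ.+ y) numerator (sym (*-identityʳ T))))
    where
    numerator : ℤ.∣ ℤ.+ P ℤ.* ℤ.+ 1 ℤ.+ ℤ.-[1+ 0 ] ℤ.* ℤ.+ T ∣ ≡ r
    numerator = trans (cong ℤ.∣_∣ (cong₂ ℤ._+_ (ℤₚ.*-identityʳ (ℤ.+ P)) (ℤₚ.-1*i≡-i (ℤ.+ T))))
      (trans (cong ℤ.∣_∣ (ℤₚ.m-n≡m⊖n P T)) (ℤₚ.∣⊖∣-≤ P≤T))
ratio-near-1 P T (ℚ.mkℚ (ℤ.+ zero) d _) (ℚ.*<* (ℤ.+<+ ()))
ratio-near-1 P T (ℚ.mkℚ ℤ.-[1+ _ ] d _) (ℚ.*<* ())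

-- Counting coefficient functions and normalized polynomials.

module Counting {c ℓ} (F : FiniteField c ℓ) where

  open Polynomials F hiding (_∸ₘ_)
  open FiniteField F
  open Finite using (elements; complete; unique)
  private module K = CommutativeRing commutativeRing

  q : ℕ
  q = Finite.card finite

  2≤q : 2 ≤ q
  2≤q = pigeonhole K.setoid {xs = K.0# ∷ K.1# ∷ []} {elements finite} K._≈_
    (((λ 0≈1 → nontrivial (K.sym 0≈1)) ∷ []) ∷ [] ∷ [])
    (complete finite)
    (λ x≈y x′≈y → K.trans x≈y (K.sym x′≈y))

  q≢0 : NonZero q
  q≢0 = ℕ.>-nonZero (≤-trans (n≤1+n 1) 2≤q)

  length-functionsOn : ∀ {k} (es : List (Monomial k)) → length (functionsOn es) ≡ q ^ length es
  length-functionsOn []       = refl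
  length-functionsOn (e ∷ es) = trans
    (length-cartesianProductWith (update e) (elements finite) (functionsOn es))
    (cong (q *_) (length-functionsOn es))

  length-boxPolys : ∀ {k} (b : Monomial k) → length (boxPolys b) ≡ q ^ volume b
  length-boxPolys b = trans (Listₚ.length-map (truncate b) (functionsOn (box b)))
    (trans (length-functionsOn (box b)) (cong (q ^_) (length-box b)))

  update-same : ∀ {k} (e : Monomial k) x h → update e x h e ≡ x
  update-same e x h with e ≟ₘ e
  ... | yes _   = refl
  ... | no  e≢e = contradiction refl e≢e

  update-other : ∀ {k} {e e′ : Monomial k} x h → ¬ e ≡ e′ → update e x h e′ ≡ h e′
  update-other {e = e} {e′} x h e≢e′ with e ≟ₘ e′
  ... | yes e≡e′ = contradiction e≡e′ e≢e′
  ... | no  _    = refl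

  truncate-coeff : ∀ {k} (b e : Monomial k) h → e ≤ₘ b → coeff (truncate b h) e ≡ h e
  truncate-coeff b e h e≤b with e ≤ₘ? b
  ... | yes _   = refl
  ... | no  e≰b = contradiction e≤b e≰b

  -- Only values on `es` count, so for duplicate-free `es` the list `functionsOn es` meets each
  -- class exactly once.
  agreeSetoid : ∀ {k} → List (Monomial k) → Setoid c ℓ
  agreeSetoid {k} es = record
    { Carrier       = Monomial k → 𝔽
    ; _≈_           = AgreeOn es
    ; isEquivalence = record
      { refl  = λ _ → K.refl
      ; sym   = λ h≈h′ e∈ → K.sym (h≈h′ e∈)
      ; trans = λ h≈h′ h′≈h″ e∈ → K.trans (h≈h′ e∈) (h′≈h″ e∈)
      }
    }

  functionsOn-unique : ∀ {k} {es : List (Monomial k)} → Unique≡ es →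
                       UniqueSetoid.Unique (agreeSetoid es) (functionsOn es)
  functionsOn-unique []                      = [] ∷ []
  functionsOn-unique {es = e ∷ es} (e∉ ∷ u) = UniqueSetoidₚ.cartesianProductWith⁺
    K.setoid (agreeSetoid es) (agreeSetoid (e ∷ es)) (update e) split (unique finite) (functionsOn-unique u)
    where
    split : ∀ {x y h h′} → AgreeOn (e ∷ es) (update e x h) (update e y h′) → x ≈𝔽 y × AgreeOn es h h′
    split {x} {y} {h} {h′} ag =
      subst₂ _≈𝔽_ (update-same e x h) (update-same e y h′) (ag (here refl)) ,
      λ e′∈ → subst₂ _≈𝔽_ (update-other x h (All.lookup e∉ e′∈)) (update-other y h′ (All.lookup e∉ e′∈))
                (ag (there e′∈))

  -- A polynomial of vector degree `m` need not contain the monomial `m`, so these form a subfamily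
  -- of the normalized polynomials, large enough for a lower bound on `N m`. The coefficient 1 at
  -- `m` forces the degree, whatever `h` is.
  monic : ∀ {k} → Monomial k → (Monomial k → 𝔽) → Poly k
  monic m h = truncate m (update m K.1# h)

  monic-top : ∀ {k} (m : Monomial k) h → coeff (monic m h) m ≡ K.1#
  monic-top m h = trans (truncate-coeff m m (update m K.1# h) ≤ₘ-refl) (update-same m K.1# h)

  monic-other : ∀ {k} {m e : Monomial k} h → e ≤ₘ m → ¬ m ≡ e → coeff (monic m h) e ≡ h e
  monic-other {m = m} {e} h e≤m m≢e = trans (truncate-coeff m e (update m K.1# h) e≤m) (update-other K.1# h m≢e)

  monic-HasDeg : ∀ {k} (m : Monomial k) h → HasDeg m (monic m h)
  monic-HasDeg m h = (λ f≈0 → top≉0 (f≈0 m)) ,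
    trans (Vecₚ.tabulate-cong deg) (Vecₚ.tabulate∘lookup m)
    where
    f = monic m h
    top≉0 : ¬ coeff f m ≈𝔽 K.0#
    top≉0 fm≈0 = nontrivial (K.trans (K.sym (K.reflexive (monic-top m h))) fm≈0)
    deg : ∀ i → degree i f ≡ lookup m i
    deg i = ≤-antisym (degree-≤ f i (λ {e} fe≉0 → Pointwise.lookup (≤ₘ-bound f {e} fe≉0) i)) (≤-degree f i {m} top≉0)

  -- A function h on the box of m is determined by h m together with the class of
  -- the polynomial obtained from h by resetting its value at m to 1.
  q^volume≤q*N : ∀ {k} (m : Monomial k) → q ^ volume m ≤ q * N m
  q^volume≤q*N m = subst₂ _≤_
    (trans (length-functionsOn (box m)) (cong (q ^_) (length-box m)))
    (length-cartesianProductWith _,_ (elements finite) (elements (𝒩-finite m)))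
    (pigeonhole (agreeSetoid (box m)) R (functionsOn-unique (box-unique m))
      (λ h → Anyₚ.cartesianProduct⁺ (complete finite (h m)) (complete (𝒩-finite m) (monic m h , monic-HasDeg m h)))
      (λ {h} {h′} {y} → R-injective {h} {h′} {y}))
    where
    R : (Monomial _ → 𝔽) → 𝔽 × Setoid.Carrier (𝒩 m) → Set _
    R h (x , (f , _)) = h m ≈𝔽 x × monic m h ∼ f

    R-injective : ∀ {h h′ y} → R h y → R h′ y → AgreeOn (box m) h h′
    R-injective {h} {h′} {_ , (f , _)} (hm≈x , h∼f) (h′m≈x , h′∼f) {e} e∈
      with ∼-trans (monic m h) f (monic m h′) h∼f (∼-sym (monic m h′) f h′∼f) | m ≟ₘ e
    ... | _            | yes refl = K.trans hm≈x (K.sym h′m≈x)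
    ... | s , _ , sh≈h′ | no  m≢e  = begin
      h e                     ≡⟨ monic-other h e≤m m≢e ⟨
      coeff (monic m h) e     ≈⟨ K.*-identityˡ _ ⟨
      K.1# K.* coeff (monic m h) e ≈⟨ K.*-congʳ s≈1 ⟨
      s K.* coeff (monic m h) e ≈⟨ sh≈h′ e ⟩
      coeff (monic m h′) e    ≡⟨ monic-other h′ e≤m m≢e ⟩
      h′ e                    ∎
      where
      open SetoidReasoning K.setoid
      e≤m = ∈-box⁻ m e∈
      -- Both polynomials have coefficient 1 at `m`, which fixes the factor of proportionality.
      s≈1 : s ≈𝔽 K.1#
      s≈1 = begin
        s                         ≈⟨ K.*-identityʳ s ⟨
        s K.* K.1#                ≡⟨ cong (s K.*_) (monic-top m h) ⟨
        s K.* coeff (monic m h) m ≈⟨ sh≈h′ m ⟩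
        coeff (monic m h′) m      ≡⟨ monic-top m h′ ⟩
        K.1#                      ∎

  -- Makes `N m * N n ∸ P m n` a true difference, as `ratio-near-1` requires.
  P≤N*N : ∀ {k} (m n : Monomial k) → P m n ≤ N m * N n
  P≤N*N m n = subst (P m n ≤_) (length-cartesianProductWith _,_ (elements (𝒩-finite m)) (elements (𝒩-finite n)))
    (pigeonhole (𝒫 m n) (λ fg gh → Setoid._≈_ (𝒩 m ×ₛ 𝒩 n) (proj₁ fg) gh) (unique (𝒫-finite m n))
      (λ ((f , g) , _) → Anyₚ.cartesianProduct⁺ (complete (𝒩-finite m) f) (complete (𝒩-finite n) g))
      (λ {x} {x′} {y} x≈y x′≈y → Setoid.trans (𝒩 m ×ₛ 𝒩 n) {proj₁ x} {y} {proj₁ x′} x≈y (Setoid.sym (𝒩 m ×ₛ 𝒩 n) {proj₁ x′} {y} x′≈y)))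

  -- Constant polynomials and degrees of factors.

  ≤0⇒≡0 : ∀ {k} {e : Monomial k} → e ≤ₘ replicate k 0 → e ≡ replicate k 0
  ≤0⇒≡0 []          = refl
  ≤0⇒≡0 (z≤n ∷ e≤0) = cong (0 ∷_) (≤0⇒≡0 e≤0)

  constant∣1 : ∀ {k} (z : Poly k) → ¬ z ≈ₚ 0ₚ → (∀ {e} → ¬ coeff z e ≈𝔽 K.0# → e ≤ₘ replicate k 0) → z ∣ 1ₚ
  constant∣1 {k} z z≉0 z≤0 with nonzero⇒support z z≉0
  ... | e , e∈ with refl ← ≤0⇒≡0 (z≤0 (∈-support⁻ z e∈)) with inverse (coeff z 𝟎) (∈-support⁻ z e∈)
    where 𝟎 = replicate k 0
  ... | y , z₀y≈1 = ∣-respˡ z₀ z 1ₚ (λ e → K.sym (z≈z₀ e)) (r , rz₀≈1)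
    where
    𝟎 = replicate k 0
    -- The recorded bound of `z` need not be sharp. Truncation resets it to zero, so the product
    -- `r *ₚ z₀` has bound zero and its other coefficients vanish by `bounded`.
    z₀ r : Poly k
    z₀ = truncate 𝟎 (coeff z)
    r  = truncate 𝟎 (λ _ → y)
    z≈z₀ : z ≈ₚ z₀
    z≈z₀ e with e ≤ₘ? 𝟎
    ... | yes _   = K.refl
    ... | no  e≰0 = decidable-stable (coeff z e ≟𝔽 K.0#) (e≰0 ∘ z≤0)
    h : Monomial k → 𝔽
    h a = coeff r a K.* coeff z₀ (𝟎 ∸ᵛ a)
    rz₀≈1 : r *ₚ z₀ ≈ₚ 1ₚ
    rz₀≈1 e with e ≤ₘ? 𝟎
    ... | no  e≰0 = K.trans
      (bounded (r *ₚ z₀) e (e≰0 ∘ subst (e ≤ₘ_) (Vecₚ.zipWith-replicate _+_ 0 0)))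
      (K.sym (bounded 1ₚ e e≰0))
    ... | yes e≤0 with refl ← ≤0⇒≡0 e≤0 = begin
      coeff (r *ₚ z₀) 𝟎        ≈⟨ sum-single h (box-unique 𝟎) (∈-box⁺ ≤ₘ-refl)
                                    (λ a∈ a≢0 → contradiction (≤0⇒≡0 (∈-box⁻ 𝟎 a∈)) a≢0) ⟩
      h 𝟎                      ≡⟨ cong₂ K._*_ (truncate-coeff 𝟎 𝟎 (λ _ → y) ≤ₘ-refl)
                                    (cong (coeff z₀) (Vecₚ.zipWith-replicate _∸_ 0 0)) ⟩
      y K.* coeff z₀ 𝟎         ≈⟨ K.*-congˡ (z≈z₀ 𝟎) ⟨
      y K.* coeff z 𝟎          ≈⟨ K.*-comm y _ ⟩
      coeff z 𝟎 K.* y          ≈⟨ z₀y≈1 ⟩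
      K.1#                     ≡⟨ term-coeff K.1# 𝟎 ⟨
      coeff 1ₚ 𝟎               ∎
      where open SetoidReasoning K.setoid

  -- In an order dominated by the variable `i`, the product of the leading monomials of `r` and `z`
  -- survives in `f`. So the degrees of `r` and `z` in that variable add up to at most `lookup m i`.
  cofactor-degree : ∀ {k} {m : Monomial k} (r z f : Poly k) → HasDeg m f → r *ₚ z ≈ₚ f →
                    Deg z ≤ₘ m × (∀ {b} → ¬ coeff r b ≈𝔽 K.0# → b ≤ₘ m ∸ᵛ Deg z)
  cofactor-degree {m = m} r z f (f≉0 , degf) rz≈f =
    lookup⇒≤ₘ (Deg z) m (λ i → ≤-trans (m≤n+m _ _) (additive i (proj₂ (nonzero⇒coeff r r≉0)))) ,
    λ {b} rb≉0 → lookup⇒≤ₘ b (m ∸ᵛ Deg z) λ i →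
      subst (lookup b i ≤_) (sym (Vecₚ.lookup-zipWith _∸_ i m (Deg z)))
        (m+n≤o⇒m≤o∸n (lookup b i) (additive i rb≉0))
    where
    factors≉0 = *ₚ-factors r z (λ rz≈0 → f≉0 λ e → K.trans (K.sym (rz≈f e)) (rz≈0 e))
    r≉0 = proj₁ factors≉0
    z≉0 = proj₂ factors≉0
    nonzero⇒coeff : ∀ r → ¬ r ≈ₚ 0ₚ → ∃[ e ] ¬ coeff r e ≈𝔽 K.0#
    nonzero⇒coeff r r≉0 = let e , e∈ = nonzero⇒support r r≉0 in e , ∈-support⁻ r e∈
    additive : ∀ i {b} → ¬ coeff r b ≈𝔽 K.0# → lookup b i + lookup (Deg z) i ≤ lookup m i
    additive i {b} rb≉0 with leading-* i r z r≉0 z≉0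
    ... | d , e , rz≉0 , r≤d , z≤e = begin
      lookup b i + lookup (Deg z) i   ≡⟨ cong (lookup b i +_) (Vecₚ.lookup∘tabulate _ i) ⟩
      lookup b i + degree i z         ≤⟨ +-mono-≤ (r≤d rb≉0) (degree-≤ z i z≤e) ⟩
      lookup d i + lookup e i         ≡⟨ Vecₚ.lookup-zipWith _+_ i d e ⟨
      lookup (d +ₘ e) i               ≤⟨ ≤-degree f i (λ fde≈0 → rz≉0 (K.trans (rz≈f (d +ₘ e)) fde≈0)) ⟩
      degree i f                      ≡⟨ Vecₚ.lookup∘tabulate _ i ⟨
      lookup (Deg f) i                ≡⟨ cong (λ v → lookup v i) degf ⟩
      lookup m i                      ∎
      where open ≤-Reasoning

  sum≡0⇒≡0 : ∀ {k} (a : Monomial k) → Vec.sum a ≡ 0 → a ≡ replicate k 0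
  sum≡0⇒≡0 []      _  = refl
  sum≡0⇒≡0 (zero ∷ a) eq = cong (0 ∷_) (sum≡0⇒≡0 a eq)

  -- Covering all pairs by coprime pairs and pairs with a common divisor.

  module _ {k} (m n : Monomial k) where

    -- The factors range over boxes instead of exact degrees, and a pair may arise several times.
    -- Overcounting is harmless for an upper bound, and the length becomes an exact power of `q`.
    commonMultiples : Monomial k → List (Poly k × Poly k)
    commonMultiples a = cartesianProductWith (λ z (r , s) → r *ₚ z , s *ₚ z)
      (boxPolys a) (cartesianProduct (boxPolys (m ∸ᵛ a)) (boxPolys (n ∸ᵛ a)))

    -- The first test discards constant divisors, which every pair has. The second keeps `n ∸ᵛ a` a
    -- true difference; for `m` this is ensured by letting `a` run through `box m`.
    candidates : Monomial k → List (Poly k × Poly k)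
    candidates a with (1 ℕ.≤? Vec.sum a) ×-dec (a ≤ₘ? n)
    ... | yes _ = commonMultiples a
    ... | no  _ = []

    candidates⁺ : ∀ {p} {Q : Poly k × Poly k → Set p} {a} → 1 ≤ Vec.sum a → a ≤ₘ n →
                  Any Q (commonMultiples a) → Any Q (candidates a)
    candidates⁺ {a = a} 1≤a a≤n any with (1 ℕ.≤? Vec.sum a) ×-dec (a ≤ₘ? n)
    ... | yes _   = any
    ... | no  bad = contradiction (1≤a , a≤n) bad

    length-commonMultiples : ∀ a → length (commonMultiples a) ≡ q ^ (volume a + (volume (m ∸ᵛ a) + volume (n ∸ᵛ a)))
    length-commonMultiples a = begin
      length (commonMultiples a)
        ≡⟨ length-cartesianProductWith _ (boxPolys a) _ ⟩
      length (boxPolys a) * length (cartesianProduct (boxPolys (m ∸ᵛ a)) (boxPolys (n ∸ᵛ a)))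
        ≡⟨ cong (length (boxPolys a) *_) (length-cartesianProductWith _,_ (boxPolys (m ∸ᵛ a)) (boxPolys (n ∸ᵛ a))) ⟩
      length (boxPolys a) * (length (boxPolys (m ∸ᵛ a)) * length (boxPolys (n ∸ᵛ a)))
        ≡⟨ cong₂ _*_ (length-boxPolys a) (cong₂ _*_ (length-boxPolys (m ∸ᵛ a)) (length-boxPolys (n ∸ᵛ a))) ⟩
      q ^ volume a * (q ^ volume (m ∸ᵛ a) * q ^ volume (n ∸ᵛ a))
        ≡⟨ cong (q ^ volume a *_) (^-distribˡ-+-* q (volume (m ∸ᵛ a)) (volume (n ∸ᵛ a))) ⟨
      q ^ volume a * q ^ (volume (m ∸ᵛ a) + volume (n ∸ᵛ a))
        ≡⟨ ^-distribˡ-+-* q (volume a) (volume (m ∸ᵛ a) + volume (n ∸ᵛ a)) ⟨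
      q ^ (volume a + (volume (m ∸ᵛ a) + volume (n ∸ᵛ a)))
        ∎
      where open ≡-Reasoning

    Proportional : Setoid.Carrier (𝒩 m ×ₛ 𝒩 n) → Poly k × Poly k → Set _
    Proportional ((f , _) , (g , _)) (f′ , g′) = f ∼ f′ × g ∼ g′

    underlying : Setoid.Carrier (𝒫 m n) → Poly k × Poly k
    underlying (((f , _) , (g , _)) , _) = f , g

    covering : List (Poly k × Poly k)
    covering = map underlying (elements (𝒫-finite m n)) ++ concatMap candidates (box m)

    commonMultiples-complete : ∀ {f g z} → HasDeg m f → HasDeg n g → z ∣ f → z ∣ g →
      Any (λ (f′ , g′) → f ∼ f′ × g ∼ g′) (commonMultiples (Deg z))
    commonMultiples-complete {f} {g} {z} degf degg (r , rz≈f) (s , sz≈g) =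
      Anyₚ.cartesianProductWith⁺ _ (λ {z′} {rs} z≈z′ (r≈r′ , s≈s′) →
          ∼-reflexive f (proj₁ rs *ₚ z′) (λ e → K.trans (K.sym (rz≈f e)) (*ₚ-cong r (proj₁ rs) z z′ r≈r′ z≈z′ e)) ,
          ∼-reflexive g (proj₂ rs *ₚ z′) (λ e → K.trans (K.sym (sz≈g e)) (*ₚ-cong s (proj₂ rs) z z′ s≈s′ z≈z′ e)))
        (boxPolys-complete (Deg z) z (≤ₘ-Deg z))
        (Anyₚ.cartesianProduct⁺
          (boxPolys-complete (m ∸ᵛ Deg z) r (proj₂ (cofactor-degree r z f degf rz≈f)))
          (boxPolys-complete (n ∸ᵛ Deg z) s (proj₂ (cofactor-degree s z g degg sz≈g))))

    -- Being covered is decidable, so it suffices to refute ¬ covered; this avoids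
    -- searching for a common divisor that witnesses non-coprimality.
    covering-complete : ∀ x → Any (Proportional x) covering
    covering-complete x@((f , f≉0 , degf) , (g , g≉0 , degg)) =
      decidable-stable (Any.any? (λ (f′ , g′) → f ∼? f′ ×-dec g ∼? g′) covering) λ uncovered →
        uncovered (Anyₚ.++⁺ˡ (Anyₚ.map⁺ (complete (𝒫-finite m n) (x , λ {z} → coprime uncovered {z}))))
      where
      coprime : ¬ Any (Proportional x) covering → Coprime f g
      coprime uncovered {z} z∣f@(r , rz≈f) z∣g@(s , sz≈g) =
        -- A common divisor not dividing 1 is nonconstant, so the pair would be covered by the
        -- candidates for `Deg z`.
        decidable-stable (∣-dec z 1ₚ (term-nonzero (replicate k 0) nontrivial)) λ z∤1 →
          uncovered (Anyₚ.++⁺ʳ _ (Anyₚ.concatMap⁺ candidates (lose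
            (∈-box⁺ (proj₁ (cofactor-degree r z f (f≉0 , degf) rz≈f)))
            (candidates⁺ (nonconstant z∤1) (proj₁ (cofactor-degree s z g (g≉0 , degg) sz≈g))
              (commonMultiples-complete (f≉0 , degf) (g≉0 , degg) z∣f z∣g)))))
        where
        z≉0 = proj₂ (*ₚ-factors r z (λ rz≈0 → f≉0 λ e → K.trans (K.sym (rz≈f e)) (rz≈0 e)))
        nonconstant : ¬ z ∣ 1ₚ → 1 ≤ Vec.sum (Deg z)
        nonconstant z∤1 = n≢0⇒n>0 λ sum≡0 → z∤1 (constant∣1 z z≉0 λ ze≉0 →
          subst (_ ≤ₘ_) (sum≡0⇒≡0 (Deg z) sum≡0) (≤ₘ-Deg z ze≉0))

    N*N≤P+candidates : N m * N n ≤ P m n + sum (map (length ∘ candidates) (box m))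
    N*N≤P+candidates = subst₂ _≤_
      (length-cartesianProductWith _,_ (elements (𝒩-finite m)) (elements (𝒩-finite n)))
      (trans (Listₚ.length-++ (map underlying (elements (𝒫-finite m n))))
        (cong₂ _+_ (Listₚ.length-map underlying (elements (𝒫-finite m n))) (length-concatMap candidates (box m))))
      (pigeonhole (𝒩 m ×ₛ 𝒩 n) Proportional
        (UniqueSetoidₚ.cartesianProduct⁺ (𝒩 m) (𝒩 n) (unique (𝒩-finite m)) (unique (𝒩-finite n)))
        covering-complete
        (λ {((f , _) , (g , _))} {((f′ , _) , (g′ , _))} {(f″ , g″)} (f∼ , g∼) (f′∼ , g′∼) →
          ∼-trans f f″ f′ f∼ (∼-sym f′ f″ f′∼) , ∼-trans g g″ g′ g∼ (∼-sym g′ g″ g′∼)))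

  -- Bounding the number of non-coprime pairs.

  module _ {j} (l : ℕ) (m n : Monomial (2 + j))
           (2L≤ : 2 * suc l ≤ last (init m)) (2L≤last : 2 * suc l ≤ last m) where

    -- With `s = Vec.sum a`, the volume gap for `L = suc l` is `s + l * s`. The first summand pays
    -- for the weight `2 ^ s` needed by `box-sum-≤`, the second for the common factor `2 ^ l`.
    candidates-bound : ∀ a → a ≤ₘ m →
      2 ^ Vec.sum a * (2 ^ l * length (candidates m n a)) ≤ q ^ suc (volume m + volume n)
    candidates-bound a a≤m with (1 ℕ.≤? Vec.sum a) ×-dec (a ≤ₘ? n)
    ... | no  _           = begin
      2 ^ Vec.sum a * (2 ^ l * 0)  ≡⟨ cong (2 ^ Vec.sum a *_) (*-zeroʳ (2 ^ l)) ⟩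
      2 ^ Vec.sum a * 0            ≡⟨ *-zeroʳ (2 ^ Vec.sum a) ⟩
      0                            ≤⟨ z≤n ⟩
      q ^ suc (volume m + volume n) ∎
      where open ≤-Reasoning
    ... | yes (1≤s , a≤n) = begin
      2 ^ s * (2 ^ l * length (commonMultiples m n a)) ≡⟨ *-assoc (2 ^ s) (2 ^ l) _ ⟨
      2 ^ s * 2 ^ l * length (commonMultiples m n a)
        ≡⟨ cong₂ _*_ (sym (^-distribˡ-+-* 2 s l)) (length-commonMultiples m n a) ⟩
      2 ^ (s + l) * q ^ (x + (y + z))  ≤⟨ *-monoˡ-≤ _ (^-monoˡ-≤ (s + l) 2≤q) ⟩
      q ^ (s + l) * q ^ (x + (y + z))  ≡⟨ ^-distribˡ-+-* q (s + l) (x + (y + z)) ⟨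
      q ^ (s + l + (x + (y + z)))      ≤⟨ ^-monoʳ-≤ q ⦃ q≢0 ⦄ exponent ⟩
      q ^ suc (volume m + volume n)    ∎
      where
      open ≤-Reasoning
      s = Vec.sum a
      x = volume a
      y = volume (m ∸ᵛ a)
      z = volume (n ∸ᵛ a)
      rearrange : ∀ s l x y z → s + l + (x + (y + z)) ≡ y + (s + l) + (x + z)
      rearrange = solve-∀
      exponent : s + l + (x + (y + z)) ≤ suc (volume m + volume n)
      exponent = begin
        s + l + (x + (y + z))        ≡⟨ rearrange s l x y z ⟩
        y + (s + l) + (x + z)        ≡⟨ cong (λ t → y + (s + t) + (x + z)) (*-identityʳ l) ⟨
        -- Here `1 ≤ s` gives `l ≤ l * s`. The successor on `volume n` is the point shared by the
        -- two boxes inside `n`.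
        y + (s + l * 1) + (x + z)    ≤⟨ +-mono-≤ (+-monoʳ-≤ y (+-monoʳ-≤ s (*-monoʳ-≤ l 1≤s))) (volume-superadditive a≤n) ⟩
        y + suc l * s + suc (volume n) ≤⟨ +-monoˡ-≤ _ (volume-gap (suc l) m a 2L≤ 2L≤last a≤m) ⟩
        volume m + suc (volume n)    ≡⟨ +-suc (volume m) (volume n) ⟩
        suc (volume m + volume n)    ∎

    -- One factor of `q ^ 3` comes from that shared point, the other two from `q^volume≤q*N` for `m`
    -- and `n`.
    candidates-sum : 2 ^ l * sum (map (length ∘ candidates m n) (box m)) ≤
                     2 ^ (2 + j) * (q ^ 3 * (N m * N n))
    candidates-sum = begin
      2 ^ l * sum (map (length ∘ candidates m n) (box m))
        ≡⟨ *-distribˡ-sum (2 ^ l) (length ∘ candidates m n) (box m) ⟩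
      sum (map (λ a → 2 ^ l * length (candidates m n a)) (box m))
        ≤⟨ box-sum-≤ m (λ a → 2 ^ l * length (candidates m n a)) candidates-bound ⟩
      2 ^ (2 + j) * (q * q ^ (volume m + volume n))
        ≡⟨ cong (λ t → 2 ^ (2 + j) * (q * t)) (^-distribˡ-+-* q (volume m) (volume n)) ⟩
      2 ^ (2 + j) * (q * (q ^ volume m * q ^ volume n))
        ≤⟨ *-monoʳ-≤ (2 ^ (2 + j)) (*-monoʳ-≤ q (*-mono-≤ (q^volume≤q*N m) (q^volume≤q*N n))) ⟩
      2 ^ (2 + j) * (q * (q * N m * (q * N n)))
        ≡⟨ cong (2 ^ (2 + j) *_) (collect q (N m) (N n)) ⟩
      2 ^ (2 + j) * (q ^ 3 * (N m * N n)) ∎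
      where
      open ≤-Reasoning
      collect : ∀ q x y → q * (q * x * (q * y)) ≡ q * (q * (q * 1)) * (x * y)
      collect = solve-∀

  -- Chosen so that `2 ^ threshold j d` is at least `2 ^ (2 + j) * (q ^ 3 * (2 * d))`: both
  -- constants of `candidates-sum` cancel and a factor `2 * d` remains.
  threshold : ℕ → ℕ → ℕ
  threshold j d = 2 + j + q ^ 3 * (2 * d)

  non-coprime-rare : ∀ {j} d (m n : Monomial (2 + j)) →
    2 * suc (threshold j d) ≤ last (init m) → 2 * suc (threshold j d) ≤ last m →
    d * (N m * N n ∸ P m n) ℕ.< N m * N n
  non-coprime-rare {j} d m n large₁ large₂ = *-cancelˡ-< 2 _ _ (begin-strict
    2 * (d * (T ∸ P m n))  ≤⟨ *-monoʳ-≤ 2 (*-monoʳ-≤ d (m≤n+o⇒m∸n≤o T (P m n) (N*N≤P+candidates m n))) ⟩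
    2 * (d * S)            ≡⟨ *-assoc 2 d S ⟨
    2 * d * S              ≤⟨ *-cancelˡ-≤ (q ^ 3) ⦃ m^n≢0 q 3 ⦃ q≢0 ⦄ ⦄
                                (*-cancelˡ-≤ (2 ^ (2 + j)) ⦃ m^n≢0 2 (2 + j) ⦄ scaled) ⟩
    -- The spare factor 2 beside `d` turns the weak estimate into a strict one, since `T` is
    -- positive.
    T                      <⟨ m<m+n T (≤-trans T>0 (m≤m+n T 0)) ⟩
    2 * T                  ∎)
    where
    open ≤-Reasoning
    T = N m * N n
    S = sum (map (length ∘ candidates m n) (box m))
    T>0 : 0 ℕ.< T
    T>0 = ℕ.>-nonZero⁻¹ T ⦃ m*n≢0 (N m) (N n) ⦃ N-nonZero m ⦄ ⦃ N-nonZero n ⦄ ⦄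
    scaled : 2 ^ (2 + j) * (q ^ 3 * (2 * d * S)) ≤ 2 ^ (2 + j) * (q ^ 3 * T)
    scaled = begin
      2 ^ (2 + j) * (q ^ 3 * (2 * d * S))            ≡⟨ regroup (2 ^ (2 + j)) (q ^ 3) (2 * d) S ⟩
      2 ^ (2 + j) * (q ^ 3 * (2 * d)) * S            ≤⟨ *-monoˡ-≤ S (*-monoʳ-≤ (2 ^ (2 + j)) (n≤2^n (q ^ 3 * (2 * d)))) ⟩
      2 ^ (2 + j) * 2 ^ (q ^ 3 * (2 * d)) * S        ≡⟨ cong (_* S) (^-distribˡ-+-* 2 (2 + j) (q ^ 3 * (2 * d))) ⟨
      2 ^ threshold j d * S                          ≤⟨ candidates-sum (threshold j d) m n large₁ large₂ ⟩
      2 ^ (2 + j) * (q ^ 3 * T)                      ∎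
      where
      regroup : ∀ x y z w → x * (y * (z * w)) ≡ x * (y * z) * w
      regroup = solve-∀

theorem5p5 : ∀ {c ℓ} (F : FiniteField c ℓ) → let open Polynomials F in
    ∀ (j : ℕ) (ε : ℚ) → 0ℚ < ε →
    ∃[ M ] (∀ (m n : Vec ℕ (2 + j)) → M ≤ last (init m) → M ≤ last m →
    ∣ coprimeRatio m n - 1ℚ ∣ < ε)
-- The bound is `2 * L` for the `L` of `volume-gap`; it depends on `F`, `j` and the denominator of
-- `ε` only.
theorem5p5 F j ε 0<ε = 2 * suc (threshold j (ℚ.↧ₙ ε)) , λ m n large₁ large₂ →
  ratio-near-1 (P m n) (N m * N n) ⦃ m*n≢0 (N m) (N n) ⦃ N-nonZero m ⦄ ⦃ N-nonZero n ⦄ ⦄ ε 0<ε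
    (P≤N*N m n) (non-coprime-rare (ℚ.↧ₙ ε) m n large₁ large₂)
  where
  open Polynomials F
  open Counting F
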